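{- Let $\mathcal{S}\subset\omega_4$ be a Segre variety $\mathcal{S}_3(2)$. Then $\mathcal{S}$ determines precisely four triplets $\mathcal{T}_i=\{\mathcal{F}_i,\mathcal{F}'_i,\mathcal{F}''_i\}$ ($i=1,2,3,4$) of fans with $\mathcal{F}_i\cup\mathcal{F}'_i\cup\mathcal{F}''_i=\mathcal{S}$, and the four resulting lines $L(\mathcal{T}_i)=\{c_{\mathcal{F}_i},c_{\mathcal{F}'_i},c_{\mathcal{F}''_i}\}$ are exactly the four lines $\mathbb{P}V_a,\mathbb{P}V_b,\mathbb{P}V_c,\mathbb{P}V_d$.
   Context: Work over $\mathbb{F}_2$. $V_8=V(8,2)$ with basis $e_1,\dots,e_8$, $V_a=\langle e_1,e_8\rangle$, $V_b=\langle e_2,e_7\rangle$, $V_c=\langle e_3,e_6\rangle$, $V_d=\langle e_4,e_5\rangle$; points of $\operatorname{PG}(7,2)$ are nonzero vectors; $\omega_4$ is the set of vectors all four of whose components in $V_a,\dots,V_d$ are nonzero. Let $\zeta_a: e_1\mapsto e_8\mapsto e_1+e_8\mapsto e_1$, $\zeta_b: e_7\mapsto e_2\mapsto e_2+e_7\mapsto e_7$, $\zeta_c: e_3\mapsto e_6\mapsto e_3+e_6\mapsto e_3$, $\zeta_d: e_5\mapsto e_4\mapsto e_4+e_5\mapsto e_5$; for $\lambda=ijkl\in\mathbb{F}_3^4$, $A_\lambda=\zeta_a^i\oplus\zeta_b^j\oplus\zeta_c^k\oplus\zeta_d^l$; $u=e_1+\dots+e_8$; $p_\lambda=A_\lambda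 u$ gives a bijection $\mathbb{F}_3^4\to\omega_4$. A Segre variety $\mathcal{S}_3(2)$ is the image under a linear isomorphism $\phi:V(2,2)^{\otimes3}\to V_8$ of the nonzero pure tensors; its generators are the $27$ lines obtained by letting one tensor factor vary with the other two fixed. A fan of $\mathcal{S}$ is a $9$-subset of $\mathcal{S}$ no two of whose points lie on a common generator. $\operatorname{hd}(p_\rho,p_\sigma)$ is the number of nonzero coordinates of $\rho-\sigma$ in the basis $\{1221,2121,2211,1111\}$ of $\mathbb{F}_3^4$; a troika is a set of three points of $\mathcal{S}$ pairwise at Hamming distance $3$, with centre the vector sum of its three points. Each fan $\mathcal{F}$ of such an $\mathcal{S}$ is uniquely a union of three troikas, all having the same centre, denoted $c_{\mathcal{F}}$; each fan $\mathcal{F}$ determines uniquely a triplet $\{\mathcal{F},\mathcal{F}',\mathcal{F}''\}$ of fans with union $\mathcal{S}$ (these are the "triplets of fans" of $\mathcal{S}$). -}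

module Defs where

open import Data.Bool using (Bool; true; false; _∧_; _∨_; _xor_; if_then_else_)
open import Data.Nat using (ℕ; zero; suc; _+_)
open import Data.Product using (Σ; Σ-syntax; _×_; _,_)
open import Data.Sum using (_⊎_)
open import Data.Vec using (Vec; []; _∷_; zipWith; replicate; foldr)
open import Data.List using (List; length; filterᵇ; concatMap) renaming ([] to []ˡ; _∷_ to _∷ˡ_)
open import Data.Fin using (Fin) renaming (zero to f0; suc to fs)
open import Relation.Binary.PropositionalEquality using (_≡_; _≢_)
open import Relation.Nullary using (¬_)
open import Function.Bundles using (_⇔_)

-- The field F₂ is Bool (xor = addition, ∧ = multiplication).

-- V₈ = V(8,2): coordinates with respect to e₁,…,e₈ (index 0 ↦ e₁, …, 7 ↦ e₈).
V8 : Set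
V8 = Vec Bool 8

_⊕_ : V8 → V8 → V8
_⊕_ = zipWith _xor_

𝟘 : V8
𝟘 = replicate 8 false

B2 : Set
B2 = Bool × Bool

NZ : B2 → Set
NZ (x , y) = (x ∨ y) ≡ true

_⊕₂_ : B2 → B2 → B2
(a , b) ⊕₂ (c , d) = (a xor c , b xor d)

_·₂_ : Bool → B2 → B2
s ·₂ (a , b) = (s ∧ a , s ∧ b)

-- components: V_a = ⟨e₁,e₈⟩, V_b = ⟨e₂,e₇⟩, V_c = ⟨e₃,e₆⟩, V_d = ⟨e₄,e₅⟩
-- each component is written in the ordered basis (lower index, higher index)
compA compB compC compD : V8 → B2
compA (a1 ∷ b2 ∷ c3 ∷ d4 ∷ d5 ∷ c6 ∷ b7 ∷ a8 ∷ []) = (a1 , a8)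
compB (a1 ∷ b2 ∷ c3 ∷ d4 ∷ d5 ∷ c6 ∷ b7 ∷ a8 ∷ []) = (b2 , b7)
compC (a1 ∷ b2 ∷ c3 ∷ d4 ∷ d5 ∷ c6 ∷ b7 ∷ a8 ∷ []) = (c3 , c6)
compD (a1 ∷ b2 ∷ c3 ∷ d4 ∷ d5 ∷ c6 ∷ b7 ∷ a8 ∷ []) = (d4 , d5)

mk : B2 → B2 → B2 → B2 → V8
mk (a1 , a8) (b2 , b7) (c3 , c6) (d4 , d5) =
  a1 ∷ b2 ∷ c3 ∷ d4 ∷ d5 ∷ c6 ∷ b7 ∷ a8 ∷ []

Ω₄ : V8 → Set
Ω₄ v = NZ (compA v) × NZ (compB v) × NZ (compC v) × NZ (compD v)

-- points of the lines ℙV_a, ℙV_b, ℙV_c, ℙV_d (nonzero vectors of V_a etc.)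
Zero₂ : B2 → Set
Zero₂ (x , y) = (x , y) ≡ (false , false)

PVa PVb PVc PVd : V8 → Set
PVa v = NZ (compA v) × Zero₂ (compB v) × Zero₂ (compC v) × Zero₂ (compD v)
PVb v = Zero₂ (compA v) × NZ (compB v) × Zero₂ (compC v) × Zero₂ (compD v)
PVc v = Zero₂ (compA v) × Zero₂ (compB v) × NZ (compC v) × Zero₂ (compD v)
PVd v = Zero₂ (compA v) × Zero₂ (compB v) × Zero₂ (compC v) × NZ (compD v)

data F3 : Set where
  o₀ o₁ o₂ : F3

_+₃_ : F3 → F3 → F3
o₀ +₃ y = y
o₁ +₃ o₀ = o₁
o₁ +₃ o₁ = o₂
o₁ +₃ o₂ = o₀
o₂ +₃ o₀ = o₂
o₂ +₃ o₁ = o₀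
o₂ +₃ o₂ = o₁

-₃_ : F3 → F3
-₃ o₀ = o₀
-₃ o₁ = o₂
-₃ o₂ = o₁

_*₃_ : F3 → F3 → F3
o₀ *₃ y = o₀
o₁ *₃ y = y
o₂ *₃ y = -₃ y

F34 : Set
F34 = Vec F3 4

_+v_ : F34 → F34 → F34
_+v_ = zipWith _+₃_

_-v_ : F34 → F34 → F34
ρ -v σ = zipWith (λ x y → x +₃ (-₃ y)) ρ σ

_·v_ : F3 → F34 → F34
s ·v (x ∷ y ∷ z ∷ w ∷ []) = (s *₃ x) ∷ (s *₃ y) ∷ (s *₃ z) ∷ (s *₃ w) ∷ []

-- the basis {1221, 2121, 2211, 1111} of F₃⁴
β₁ β₂ β₃ β₄ : F34
β₁ = o₁ ∷ o₂ ∷ o₂ ∷ o₁ ∷ []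
β₂ = o₂ ∷ o₁ ∷ o₂ ∷ o₁ ∷ []
β₃ = o₂ ∷ o₂ ∷ o₁ ∷ o₁ ∷ []
β₄ = o₁ ∷ o₁ ∷ o₁ ∷ o₁ ∷ []

comb : F34 → F34
comb (c₁ ∷ c₂ ∷ c₃ ∷ c₄ ∷ []) =
  (c₁ ·v β₁) +v ((c₂ ·v β₂) +v ((c₃ ·v β₃) +v (c₄ ·v β₄)))

nzCount : F34 → ℕ
nzCount = foldr _ (λ { o₀ n → n ; o₁ n → suc n ; o₂ n → suc n }) 0

lin2 : B2 → B2 → B2 → B2
lin2 im₁ im₂ (x , y) = (x ·₂ im₁) ⊕₂ (y ·₂ im₂)

-- ζ_a : e₁ ↦ e₈ ↦ e₁+e₈ ↦ e₁   (basis (e₁,e₈))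
ζa : B2 → B2
ζa = lin2 (false , true) (true , true)
-- ζ_b : e₇ ↦ e₂ ↦ e₂+e₇ ↦ e₇   (basis (e₂,e₇))
ζb : B2 → B2
ζb = lin2 (true , true) (true , false)
-- ζ_c : e₃ ↦ e₆ ↦ e₃+e₆ ↦ e₃   (basis (e₃,e₆))
ζc : B2 → B2
ζc = lin2 (false , true) (true , true)
-- ζ_d : e₅ ↦ e₄ ↦ e₄+e₅ ↦ e₅   (basis (e₄,e₅))
ζd : B2 → B2
ζd = lin2 (true , true) (true , false)

pow : F3 → (B2 → B2) → B2 → B2
pow o₀ f x = x
pow o₁ f x = f x
pow o₂ f x = f (f x)

A : F34 → V8 → V8
A (i ∷ j ∷ k ∷ l ∷ []) v =
  mk (pow i ζa (compA v)) (pow j ζb (compB v)) (pow k ζc (compC v)) (pow l ζd (compD v))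

u : V8
u = replicate 8 true

p : F34 → V8
p λ' = A λ' u

HD3 : V8 → V8 → Set
HD3 x y = Σ[ ρ ∈ F34 ] Σ[ σ ∈ F34 ] (p ρ ≡ x) × (p σ ≡ y) ×
          (Σ[ c ∈ F34 ] (comb c ≡ ρ -v σ) × (nzCount c ≡ 3))

-- V(2,2)^{⊗3} in the basis e_i ⊗ e_j ⊗ e_k, ordered lexicographically
Tensor3 : Set
Tensor3 = Vec Bool 8

_⊗_⊗_ : B2 → B2 → B2 → Tensor3
(x₀ , x₁) ⊗ (y₀ , y₁) ⊗ (z₀ , z₁) =
  (x₀ ∧ y₀ ∧ z₀) ∷ (x₀ ∧ y₀ ∧ z₁) ∷ (x₀ ∧ y₁ ∧ z₀) ∷ (x₀ ∧ y₁ ∧ z₁) ∷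
  (x₁ ∧ y₀ ∧ z₀) ∷ (x₁ ∧ y₀ ∧ z₁) ∷ (x₁ ∧ y₁ ∧ z₀) ∷ (x₁ ∧ y₁ ∧ z₁) ∷ []

-- linear isomorphism V(2,2)^{⊗3} → V₈ (over F₂ linear = additive)
IsLinIso : (Tensor3 → V8) → Set
IsLinIso φ = (∀ x y → φ (zipWith _xor_ x y) ≡ φ x ⊕ φ y) ×
             (Σ[ ψ ∈ (V8 → Tensor3) ] (∀ x → ψ (φ x) ≡ x) × (∀ y → φ (ψ y) ≡ y))

InS : (Tensor3 → V8) → V8 → Set
InS φ v = Σ[ x ∈ B2 ] Σ[ y ∈ B2 ] Σ[ z ∈ B2 ]
          NZ x × NZ y × NZ z × (φ (x ⊗ y ⊗ z) ≡ v)

InGen : (Tensor3 → V8) → Fin 3 → B2 → B2 → V8 → Set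
InGen φ f0           s t v = Σ[ x ∈ B2 ] NZ x × (φ (x ⊗ s ⊗ t) ≡ v)
InGen φ (fs f0)      s t v = Σ[ x ∈ B2 ] NZ x × (φ (s ⊗ x ⊗ t) ≡ v)
InGen φ (fs (fs f0)) s t v = Σ[ x ∈ B2 ] NZ x × (φ (s ⊗ t ⊗ x) ≡ v)

CommonGen : (Tensor3 → V8) → V8 → V8 → Set
CommonGen φ x y = Σ[ k ∈ Fin 3 ] Σ[ s ∈ B2 ] Σ[ t ∈ B2 ]
                  NZ s × NZ t × InGen φ k s t x × InGen φ k s t y

-- subsets of V₈ as Boolean predicates; cardinality by enumeration

allB : (n : ℕ) → List (Vec Bool n)
allB zero = [] ∷ˡ []ˡ
allB (suc n) = concatMap (λ v → (false ∷ v) ∷ˡ (true ∷ v) ∷ˡ []ˡ) (allB n)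

card : (V8 → Bool) → ℕ
card F = length (filterᵇ F (allB 8))

IsFan : (Tensor3 → V8) → (V8 → Bool) → Set
IsFan φ F = (∀ v → F v ≡ true → InS φ v) × (card F ≡ 9) ×
            (∀ x y → F x ≡ true → F y ≡ true → x ≢ y → ¬ CommonGen φ x y)

IsTroikaWithCentre : (Tensor3 → V8) → V8 → V8 → V8 → V8 → Set
IsTroikaWithCentre φ x y z c =
  InS φ x × InS φ y × InS φ z × HD3 x y × HD3 y z × HD3 x z ×
  ((x ⊕ y) ⊕ z ≡ c)

IsCentre : (Tensor3 → V8) → (V8 → Bool) → V8 → Set
IsCentre φ F c =
  Σ[ x₁ ∈ V8 ] Σ[ y₁ ∈ V8 ] Σ[ z₁ ∈ V8 ]
  Σ[ x₂ ∈ V8 ] Σ[ y₂ ∈ V8 ] Σ[ z₂ ∈ V8 ]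
  Σ[ x₃ ∈ V8 ] Σ[ y₃ ∈ V8 ] Σ[ z₃ ∈ V8 ]
    IsTroikaWithCentre φ x₁ y₁ z₁ c ×
    IsTroikaWithCentre φ x₂ y₂ z₂ c ×
    IsTroikaWithCentre φ x₃ y₃ z₃ c ×
    (∀ v → (F v ≡ true) ⇔
      ((v ≡ x₁ ⊎ v ≡ y₁ ⊎ v ≡ z₁) ⊎ (v ≡ x₂ ⊎ v ≡ y₂ ⊎ v ≡ z₂) ⊎
       (v ≡ x₃ ⊎ v ≡ y₃ ⊎ v ≡ z₃)))

IsCF : (Tensor3 → V8) → (V8 → Bool) → V8 → Set
IsCF φ F c = IsCentre φ F c × (∀ c' → IsCentre φ F c' → c' ≡ c)

-- triplets of fans {F, F', F''} with union 𝒮 (given by an ordering)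
record Triplet (φ : Tensor3 → V8) : Set where
  field
    F₁ F₂ F₃ : V8 → Bool
    fan₁ : IsFan φ F₁
    fan₂ : IsFan φ F₂
    fan₃ : IsFan φ F₃
    union : ∀ v → ((F₁ v ∨ F₂ v ∨ F₃ v) ≡ true) ⇔ InS φ v
open Triplet public

_≐_ : (V8 → Bool) → (V8 → Bool) → Set
F ≐ G = ∀ v → F v ≡ G v

-- equality of triplets as unordered sets of fans
SameTriplet : {φ : Tensor3 → V8} → Triplet φ → Triplet φ → Set
SameTriplet T U =
  (F₁ T ≐ F₁ U ⊎ F₁ T ≐ F₂ U ⊎ F₁ T ≐ F₃ U) ×
  (F₂ T ≐ F₁ U ⊎ F₂ T ≐ F₂ U ⊎ F₂ T ≐ F₃ U) ×
  (F₃ T ≐ F₁ U ⊎ F₃ T ≐ F₂ U ⊎ F₃ T ≐ F₃ U) ×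
  (F₁ U ≐ F₁ T ⊎ F₁ U ≐ F₂ T ⊎ F₁ U ≐ F₃ T) ×
  (F₂ U ≐ F₁ T ⊎ F₂ U ≐ F₂ T ⊎ F₂ U ≐ F₃ T) ×
  (F₃ U ≐ F₁ T ⊎ F₃ U ≐ F₂ T ⊎ F₃ U ≐ F₃ T)

LineIs : {φ : Tensor3 → V8} → Triplet φ → (V8 → Set) → Set
LineIs {φ} T L = Σ[ c₁ ∈ V8 ] Σ[ c₂ ∈ V8 ] Σ[ c₃ ∈ V8 ]
  IsCF φ (F₁ T) c₁ × IsCF φ (F₂ T) c₂ × IsCF φ (F₃ T) c₃ ×
  (∀ v → (v ≡ c₁ ⊎ v ≡ c₂ ⊎ v ≡ c₃) ⇔ L v)

{-# OPTIONS --safe #-}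
module Submission where

-- Index the three nonzero vectors of V(2,2) by F₃, so that 𝒮 becomes the cube F₃³.
-- Each of the four components of a point of 𝒮 is then a map F₃³ → F₃ which is
-- injective in each variable, because the three points of a generator sum to zero;
-- such a map is c ± i ± j ± k. Two components with the same sign pattern, up to a
-- common sign, would be linearly dependent, so the four components realise the four
-- sign classes. A fan meets every generator, hence is the graph of a Latin square of
-- order 3, i.e. a plane k ± i ± j = m: it is cut out by fixing one component X.
-- Three such planes cover the cube only if they are parallel, so the triplets
-- correspond to the four components. Since β₁, …, β₄ is orthonormal mod 3, two points
-- of ω₄ are at Hamming distance 3 iff exactly one of their components agrees; hence a
-- troika in a fan shares the X-component, while in the other components it runs
-- through all nonzero vectors, so its sum is that X-component.

open import Defs
open import Data.Bool using (Bool; true; false; _∨_; _xor_; not; if_then_else_)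
import Data.Bool.Properties as Bool
open import Data.Nat using (zero; suc; _≤_; z≤n; s≤s)
import Data.Nat.Properties as ℕ
open import Data.Fin using (Fin; punchOut) renaming (zero to f0; suc to fs)
import Data.Fin.Properties as Fin
open import Data.Product using (Σ-syntax; ∃; ∃-syntax; _×_; _,_; proj₁; proj₂; uncurry)
import Data.Product.Properties as Product
open import Data.Sum as Sum using (_⊎_; inj₁; inj₂; [_,_]′)
open import Data.Vec using (Vec; []; _∷_; lookup; tabulate; zipWith)
import Data.Vec.Properties as Vec
open import Data.List using (List; []; _∷_; _++_; length; map; filter; concatMap; cartesianProduct)
open import Data.List.Properties using (length-++; length-map)
open import Data.List.Relation.Unary.All as All using ([]; _∷_)
open import Data.List.Relation.Unary.Any using (here; there)
open import Data.List.Relation.Unary.AllPairs using ([]; _∷_)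
open import Data.List.Relation.Unary.Unique.Propositional using (Unique)
import Data.List.Relation.Unary.Unique.Propositional.Properties as Unique
open import Data.List.Membership.Propositional using (_∈_)
import Data.List.Membership.Propositional.Properties as ∈
open import Data.List.Relation.Binary.Subset.Propositional using (_⊆_)
open import Function using (_∘_; case_of_)
open import Function.Bundles using (mk⇔; Equivalence)
open import Function.Definitions using (Injective)
open import Relation.Binary.Definitions using (DecidableEquality)
open import Relation.Binary.PropositionalEquality
open import Relation.Nullary using (¬_; Dec; yes; no; does; contradiction)
open import Relation.Nullary.Decidable
  using (map′; from-yes; ¬?; _×-dec_; _⊎-dec_; _→-dec_; dec-true; dec-false; decidable-stable; T?)

open Equivalence using (to; from)

-- Cardinality of subsets of V₈

-- The head `x` occurs in `ys`; deleting that occurrence leaves room for `xs`, which avoids `x` by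
-- uniqueness. This pigeonhole principle serves both the computation of `card` and the counting of
-- generators met by a fan.
Unique-⊆⇒length≤ : {A : Set} {xs ys : List A} →
                   Unique xs → xs ⊆ ys → length xs ≤ length ys
Unique-⊆⇒length≤ [] _ = z≤n
Unique-⊆⇒length≤ {xs = x ∷ xs} (x∉xs ∷ uxs) sub
  with ys₁ , ys₂ , refl ← ∈.∈-∃++ (sub (here refl)) =
  ℕ.≤-trans (s≤s (Unique-⊆⇒length≤ uxs rest)) (ℕ.≤-reflexive size)
  where
  rest : xs ⊆ ys₁ ++ ys₂
  rest z∈xs with ∈.∈-++⁻ ys₁ (sub (there z∈xs))
  ... | inj₁ z∈ys₁ = ∈.∈-++⁺ˡ z∈ys₁
  ... | inj₂ (here refl) = contradiction refl (All.lookup x∉xs z∈xs)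
  ... | inj₂ (there z∈ys₂) = ∈.∈-++⁺ʳ ys₁ z∈ys₂
  size : suc (length (ys₁ ++ ys₂)) ≡ length (ys₁ ++ x ∷ ys₂)
  size = trans (cong suc (length-++ ys₁))
               (trans (sym (ℕ.+-suc (length ys₁) _)) (sym (length-++ ys₁)))

private
  extend : ∀ {n} → Vec Bool n → List (Vec Bool (suc n))
  extend v = (false ∷ v) ∷ (true ∷ v) ∷ []

extend-tail : ∀ {n} (vs : List (Vec Bool n)) {b w} → (b ∷ w) ∈ concatMap extend vs → w ∈ vs
extend-tail (v ∷ vs) (here refl) = here refl
extend-tail (v ∷ vs) (there (here refl)) = here refl
extend-tail (v ∷ vs) (there (there p)) = there (extend-tail vs p)

extend-unique : ∀ {n} {vs : List (Vec Bool n)} → Unique vs → Unique (concatMap extend vs)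
extend-unique [] = []
extend-unique {vs = v ∷ vs} (v∉vs ∷ uvs) =
  ((λ ()) ∷ All.tabulate new) ∷ All.tabulate new ∷ extend-unique uvs
  where
  new : ∀ {b w} → w ∈ concatMap extend vs → b ∷ v ≢ w
  new w∈ refl = All.lookup v∉vs (extend-tail vs w∈) refl

allB-unique : ∀ n → Unique (allB n)
allB-unique zero = [] ∷ []
allB-unique (suc n) = extend-unique (allB-unique n)

∈-extend : ∀ {n} {vs : List (Vec Bool n)} b {w} → w ∈ vs → (b ∷ w) ∈ concatMap extend vs
∈-extend false (here refl) = here refl
∈-extend true (here refl) = there (here refl)
∈-extend b (there w∈) = there (there (∈-extend b w∈))

∈-allB : ∀ {n} (v : Vec Bool n) → v ∈ allB n
∈-allB [] = here refl
∈-allB (b ∷ v) = ∈-extend b (∈-allB v)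

-- Phrased with the decidable `filter` to make its membership lemmas available; its length is
-- `card F` by computation.
members : (V8 → Bool) → List V8
members F = filter (T? ∘ F) (allB 8)

members-unique : ∀ F → Unique (members F)
members-unique F = Unique.filter⁺ (T? ∘ F) (allB-unique 8)

∈-members⁺ : ∀ F {v} → F v ≡ true → v ∈ members F
∈-members⁺ F Fv = ∈.∈-filter⁺ (T? ∘ F) (∈-allB _) (from Bool.T-≡ Fv)

∈-members⁻ : ∀ F {v} → v ∈ members F → F v ≡ true
∈-members⁻ F v∈ = to Bool.T-≡ (proj₂ (∈.∈-filter⁻ (T? ∘ F) {xs = allB 8} v∈))

card-≡ : ∀ F {xs} → Unique xs → (∀ v → F v ≡ true → v ∈ xs) →
         (∀ {v} → v ∈ xs → F v ≡ true) → card F ≡ length xs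
card-≡ F uxs F⊆xs xs⊆F = ℕ.≤-antisym
  (Unique-⊆⇒length≤ (members-unique F) (λ v∈ → F⊆xs _ (∈-members⁻ F v∈)))
  (Unique-⊆⇒length≤ uxs (λ v∈ → ∈-members⁺ F (xs⊆F v∈)))

-- Exhaustive search

_≟₃_ : DecidableEquality F3
o₀ ≟₃ o₀ = yes refl
o₀ ≟₃ o₁ = no λ ()
o₀ ≟₃ o₂ = no λ ()
o₁ ≟₃ o₀ = no λ ()
o₁ ≟₃ o₁ = yes refl
o₁ ≟₃ o₂ = no λ ()
o₂ ≟₃ o₀ = no λ ()
o₂ ≟₃ o₁ = no λ ()
o₂ ≟₃ o₂ = yes refl

_≟₂_ : DecidableEquality B2
_≟₂_ = Product.≡-dec Bool._≟_ Bool._≟_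

_≟₈_ : DecidableEquality V8
_≟₈_ = Vec.≡-dec Bool._≟_

∀₃? : {P : F3 → Set} → (∀ x → Dec (P x)) → Dec (∀ x → P x)
∀₃? P? = map′ (λ { (a , b , c) → λ { o₀ → a ; o₁ → b ; o₂ → c } })
              (λ f → f o₀ , f o₁ , f o₂) (P? o₀ ×-dec (P? o₁ ×-dec P? o₂))

∃₃? : {P : F3 → Set} → (∀ x → Dec (P x)) → Dec (∃ P)
∃₃? P? = map′ [ (o₀ ,_) , [ (o₁ ,_) , (o₂ ,_) ]′ ]′
              (λ { (o₀ , p) → inj₁ p ; (o₁ , p) → inj₂ (inj₁ p) ; (o₂ , p) → inj₂ (inj₂ p) })
              (P? o₀ ⊎-dec (P? o₁ ⊎-dec P? o₂))

∀ᵇ? : {P : Bool → Set} → (∀ x → Dec (P x)) → Dec (∀ x → P x)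
∀ᵇ? P? = map′ (λ { (a , b) → λ { false → a ; true → b } })
              (λ f → f false , f true) (P? false ×-dec P? true)

∃ᵇ? : {P : Bool → Set} → (∀ x → Dec (P x)) → Dec (∃ P)
∃ᵇ? P? = map′ [ (false ,_) , (true ,_) ]′
              (λ { (false , p) → inj₁ p ; (true , p) → inj₂ p })
              (P? false ⊎-dec P? true)

∀₂? : {P : B2 → Set} → (∀ x → Dec (P x)) → Dec (∀ x → P x)
∀₂? P? = map′ uncurry (λ f a b → f (a , b)) (∀ᵇ? λ a → ∀ᵇ? λ b → P? (a , b))

∃₂? : {P : B2 → Set} → (∀ x → Dec (P x)) → Dec (∃ P)
∃₂? P? = map′ (λ { (a , b , p) → (a , b) , p }) (λ { ((a , b) , p) → a , b , p })
              (∃ᵇ? λ a → ∃ᵇ? λ b → P? (a , b))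

∀₃₄? : {P : F34 → Set} → (∀ x → Dec (P x)) → Dec (∀ x → P x)
∀₃₄? P? = map′ (λ { f (a ∷ b ∷ c ∷ d ∷ []) → f a b c d }) (λ f a b c d → f _)
               (∀₃? λ a → ∀₃? λ b → ∀₃? λ c → ∀₃? λ d → P? (a ∷ b ∷ c ∷ d ∷ []))

NZ? : ∀ b → Dec (NZ b)
NZ? (x , y) = (x ∨ y) Bool.≟ true

-- Affine functions over F₃

F3s : List F3
F3s = o₀ ∷ o₁ ∷ o₂ ∷ []

∈-F3s : ∀ x → x ∈ F3s
∈-F3s o₀ = here refl
∈-F3s o₁ = there (here refl)
∈-F3s o₂ = there (there (here refl))

F3s-unique : Unique F3s
F3s-unique = ((λ ()) ∷ (λ ()) ∷ []) ∷ ((λ ()) ∷ []) ∷ [] ∷ []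

sgn : Bool → F3 → F3
sgn false x = x
sgn true x = -₃ x

affine : Bool → F3 → F3 → F3
affine s c x = sgn s x +₃ c

affine-injective : ∀ s c {x y} → affine s c x ≡ affine s c y → x ≡ y
affine-injective s c {x} {y} =
  from-yes (∀ᵇ? λ s → ∀₃? λ c → ∀₃? λ x → ∀₃? λ y →
            (affine s c x ≟₃ affine s c y) →-dec (x ≟₃ y)) s c x y

affine-surjective : ∀ s c y → ∃[ x ] affine s c x ≡ y
affine-surjective =
  from-yes (∀ᵇ? λ s → ∀₃? λ c → ∀₃? λ y → ∃₃? λ x → affine s c x ≟₃ y)

-- With opposite signs the difference of the two functions has slope 2 or -2, invertible mod 3, so
-- it vanishes somewhere.
affine-intersect : ∀ s s′ c c′ → (∀ x → affine s c x ≢ affine s′ c′ x) → s ≡ s′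
affine-intersect =
  from-yes (∀ᵇ? λ s → ∀ᵇ? λ s′ → ∀₃? λ c → ∀₃? λ c′ →
            (∀₃? λ x → ¬? (affine s c x ≟₃ affine s′ c′ x)) →-dec (s Bool.≟ s′))

affine-slope : ∀ s s′ c → affine s c o₁ ≡ affine s′ c o₁ → s ≡ s′
affine-slope =
  from-yes (∀ᵇ? λ s → ∀ᵇ? λ s′ → ∀₃? λ c →
            (affine s c o₁ ≟₃ affine s′ c o₁) →-dec (s Bool.≟ s′))

affine-o₀ : ∀ s c → c ≡ affine s c o₀
affine-o₀ = from-yes (∀ᵇ? λ s → ∀₃? λ c → c ≟₃ affine s c o₀)

-- All six permutations of F₃ have the form `x ↦ ±x + c`.
distinct⇒affine : ∀ a b c → a ≢ b → a ≢ c → b ≢ c →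
                  ∃[ s ] b ≡ affine s a o₁ × c ≡ affine s a o₂
distinct⇒affine =
  from-yes (∀₃? λ a → ∀₃? λ b → ∀₃? λ c →
            ¬? (a ≟₃ b) →-dec (¬? (a ≟₃ c) →-dec (¬? (b ≟₃ c) →-dec
            ∃ᵇ? λ s → (b ≟₃ affine s a o₁) ×-dec (c ≟₃ affine s a o₂))))

injective⇒affine : (f : F3 → F3) → Injective _≡_ _≡_ f →
                   ∃[ s ] ∀ x → f x ≡ affine s (f o₀) x
injective⇒affine f inj
  with s , e₁ , e₂ ← distinct⇒affine (f o₀) (f o₁) (f o₂)
         (λ e → case inj e of λ ()) (λ e → case inj e of λ ()) (λ e → case inj e of λ ()) =
  s , λ { o₀ → affine-o₀ s (f o₀) ; o₁ → e₁ ; o₂ → e₂ }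

-- All rows have the same slope because graphs of different slopes meet.
latin-slope : (f : F3 → F3 → F3) →
              (∀ y → Injective _≡_ _≡_ (f y)) → (∀ x → Injective _≡_ _≡_ (λ y → f y x)) →
              ∃[ s ] ∀ y x → f y x ≡ affine s (f y o₀) x
latin-slope f row col = slope o₀ , λ y x →
  trans (value y x) (cong (λ s → affine s (f y o₀) x) (same y))
  where
  slope = λ y → proj₁ (injective⇒affine (f y) (row y))
  value = λ y → proj₂ (injective⇒affine (f y) (row y))
  same : ∀ y → slope y ≡ slope o₀
  same y with y ≟₃ o₀
  ... | yes refl = refl
  ... | no y≢o₀ = affine-intersect _ _ _ _ λ x e →
    y≢o₀ (col x (trans (value y x) (trans e (sym (value o₀ x)))))

latin-square : (f : F3 → F3 → F3) →
               (∀ y → Injective _≡_ _≡_ (f y)) → (∀ x → Injective _≡_ _≡_ (λ y → f y x)) →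
               ∃[ s ] ∃[ t ] ∃[ c ] ∀ y x → f y x ≡ affine s (affine t c y) x
latin-square f row col
  with s , f≡ ← latin-slope f row col
     | t , f₀≡ ← injective⇒affine (λ y → f y o₀) (col o₀) =
  s , t , f o₀ o₀ , λ y x → trans (f≡ y x) (cong (λ c → affine s c x) (f₀≡ y))

-- Each layer of constant `k` has its own slope in `i`. The slice `j = o₀` crosses all layers and is
-- itself a Latin square, which forces these slopes to agree; the face `i = o₀` supplies the
-- intercepts.
latin-cube : (g : F3 → F3 → F3 → F3) →
             (∀ j k → Injective _≡_ _≡_ (λ i → g i j k)) →
             (∀ i k → Injective _≡_ _≡_ (λ j → g i j k)) →
             (∀ i j → Injective _≡_ _≡_ (g i j)) →
             ∃[ s ] ∃[ t ] ∃[ r ] ∃[ c ] ∀ i j k →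
             g i j k ≡ affine s (affine t (affine r c k) j) i
latin-cube g inj-i inj-j inj-k
  with s , g≡ ← latin-slope (λ k i → g i o₀ k) (inj-i o₀) (λ i → inj-k i o₀)
     | r , t , c , g₀≡ ← latin-square (λ k j → g o₀ j k) (inj-j o₀) (inj-k o₀) =
  s , r , t , c , λ i j k →
    trans (layer k j i)
    (trans (cong (λ s → affine s (g o₀ j k) i) (same k))
           (cong (λ c → affine s c i) (g₀≡ k j)))
  where
  layer-slope = λ k → latin-slope (λ j i → g i j k) (λ j → inj-i j k) (λ i → inj-j i k)
  layer = λ k → proj₂ (layer-slope k)
  same : ∀ k → proj₁ (layer-slope k) ≡ s
  same k = affine-slope _ _ (g o₀ o₀ k) (trans (sym (layer k o₀ o₁)) (g≡ k o₁))

-- The four classes of sign patterns (±, ±, ±) modulo a common sign: the third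
-- sign is normalised to +.
Class : Set
Class = Bool × Bool

_≟ᶜ_ : DecidableEquality Class
_≟ᶜ_ = _≟₂_

ℓ : Class → F3 → F3 → F3 → F3
ℓ (s , t) i j k = k +₃ (sgn s i +₃ sgn t j)

affine⇒ℓ : ∀ s t r → ∃[ κ ] ∀ c i j k →
           affine s (affine t (affine r c k) j) i ≡ affine r c (ℓ κ i j k)
affine⇒ℓ s t r = (s xor r , t xor r) , from-yes (∀ᵇ? λ s → ∀ᵇ? λ t → ∀ᵇ? λ r →
  ∀₃? λ c → ∀₃? λ i → ∀₃? λ j → ∀₃? λ k →
  affine s (affine t (affine r c k) j) i ≟₃ affine r c (ℓ (s xor r , t xor r) i j k)) s t r

latin-cube-class : (g : F3 → F3 → F3 → F3) →
                   (∀ j k → Injective _≡_ _≡_ (λ i → g i j k)) →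
                   (∀ i k → Injective _≡_ _≡_ (λ j → g i j k)) →
                   (∀ i j → Injective _≡_ _≡_ (g i j)) →
                   ∃[ κ ] ∃[ r ] ∃[ c ] ∀ i j k → g i j k ≡ affine r c (ℓ κ i j k)
latin-cube-class g inj-i inj-j inj-k =
  let s , t , r , c , g≡ = latin-cube g inj-i inj-j inj-k
      κ , normalise = affine⇒ℓ s t r
  in κ , r , c , λ i j k → trans (g≡ i j k) (normalise c i j k)

-- Moving the `i` and `j` terms to the side of `k` negates their signs. In the nested `affine` the
-- inner sign `t` belongs to `i`, so the class is `(not t , not s)`.
ℓ-graph : ∀ s t → ∃[ κ ] ∀ c i j k →
          (k ≡ affine s (affine t c i) j → ℓ κ i j k ≡ c) ×
          (ℓ κ i j k ≡ c → k ≡ affine s (affine t c i) j)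
ℓ-graph s t = (not t , not s) , from-yes (∀ᵇ? λ s → ∀ᵇ? λ t →
  ∀₃? λ c → ∀₃? λ i → ∀₃? λ j → ∀₃? λ k →
  ((k ≟₃ affine s (affine t c i) j) →-dec (ℓ (not t , not s) i j k ≟₃ c)) ×-dec
  ((ℓ (not t , not s) i j k ≟₃ c) →-dec (k ≟₃ affine s (affine t c i) j))) s t

ℓ-injective : ∀ κ i j k i′ j′ k′ → ℓ κ i j k ≡ ℓ κ i′ j′ k′ →
              (j ≡ j′ → k ≡ k′ → i ≡ i′) × (i ≡ i′ → k ≡ k′ → j ≡ j′) ×
              (i ≡ i′ → j ≡ j′ → k ≡ k′)
ℓ-injective κ i j k i′ j′ k′ e =
  (λ { refl refl → proj₁ (cancel κ) _ i j k e }) ,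
  (λ { refl refl → proj₁ (proj₂ (cancel κ)) _ i j k e }) ,
  (λ { refl refl → proj₂ (proj₂ (cancel κ)) _ i j k e })
  where
  cancel : ∀ κ →
    (∀ x i j k → ℓ κ i j k ≡ ℓ κ x j k → i ≡ x) ×
    (∀ x i j k → ℓ κ i j k ≡ ℓ κ i x k → j ≡ x) ×
    (∀ x i j k → ℓ κ i j k ≡ ℓ κ i j x → k ≡ x)
  cancel = from-yes (∀₂? λ κ →
    (∀₃? λ x → ∀₃? λ i → ∀₃? λ j → ∀₃? λ k → (ℓ κ i j k ≟₃ ℓ κ x j k) →-dec (i ≟₃ x)) ×-dec
    (∀₃? λ x → ∀₃? λ i → ∀₃? λ j → ∀₃? λ k → (ℓ κ i j k ≟₃ ℓ κ i x k) →-dec (j ≟₃ x)) ×-dec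
    (∀₃? λ x → ∀₃? λ i → ∀₃? λ j → ∀₃? λ k → (ℓ κ i j k ≟₃ ℓ κ i j x) →-dec (k ≟₃ x)))

-- Forms of different classes are not proportional, so together they map F₃³ onto F₃².
ℓ-independent : ∀ κ κ′ → κ ≢ κ′ → ∀ m m′ →
                ∃[ i ] ∃[ j ] ∃[ k ] ℓ κ i j k ≡ m × ℓ κ′ i j k ≡ m′
ℓ-independent =
  from-yes (∀₂? λ κ → ∀₂? λ κ′ → ¬? (κ ≟ᶜ κ′) →-dec ∀₃? λ m → ∀₃? λ m′ →
            ∃₃? λ i → ∃₃? λ j → ∃₃? λ k → (ℓ κ i j k ≟₃ m) ×-dec (ℓ κ′ i j k ≟₃ m′))

-- Three planes of nine points cover 27 points only if they are pairwise disjoint, hence parallel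
-- and at three different levels.
ℓ-cover : ∀ κ₁ κ₂ κ₃ m₁ m₂ m₃ →
          (∀ i j k → ℓ κ₁ i j k ≡ m₁ ⊎ ℓ κ₂ i j k ≡ m₂ ⊎ ℓ κ₃ i j k ≡ m₃) →
          κ₁ ≡ κ₂ × κ₂ ≡ κ₃ × (∀ m → m ≡ m₁ ⊎ m ≡ m₂ ⊎ m ≡ m₃)
ℓ-cover =
  from-yes (∀₂? λ κ₁ → ∀₂? λ κ₂ → ∀₂? λ κ₃ → ∀₃? λ m₁ → ∀₃? λ m₂ → ∀₃? λ m₃ →
    (∀₃? λ i → ∀₃? λ j → ∀₃? λ k →
      (ℓ κ₁ i j k ≟₃ m₁) ⊎-dec ((ℓ κ₂ i j k ≟₃ m₂) ⊎-dec (ℓ κ₃ i j k ≟₃ m₃))) →-dec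
    ((κ₁ ≟ᶜ κ₂) ×-dec ((κ₂ ≟ᶜ κ₃) ×-dec
      ∀₃? λ m → (m ≟₃ m₁) ⊎-dec ((m ≟₃ m₂) ⊎-dec (m ≟₃ m₃)))))

-- The plane ℓ κ = c is a union of three lines in the direction (s , t , 1); the
-- n-th point of the m-th line is (planeI , planeJ , n).
planeI planeJ : Class → F3 → F3 → F3 → F3
planeI (s , t) c m n = sgn s (m +₃ n)
planeJ (s , t) c m n = sgn t ((c +₃ (-₃ m)) +₃ n)

ℓ-plane : ∀ κ c m n → ℓ κ (planeI κ c m n) (planeJ κ c m n) n ≡ c
ℓ-plane = from-yes (∀₂? λ κ → ∀₃? λ c → ∀₃? λ m → ∀₃? λ n →
  ℓ κ (planeI κ c m n) (planeJ κ c m n) n ≟₃ c)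

plane-complete : ∀ κ i j n → ∃[ m ] planeI κ (ℓ κ i j n) m n ≡ i × planeJ κ (ℓ κ i j n) m n ≡ j
plane-complete = from-yes (∀₂? λ κ → ∀₃? λ i → ∀₃? λ j → ∀₃? λ n → ∃₃? λ m →
  (planeI κ (ℓ κ i j n) m n ≟₃ i) ×-dec (planeJ κ (ℓ κ i j n) m n ≟₃ j))

-- Along the direction `(s , t , 1)` the form of class `(s′ , t′)` has slope `ss′ + tt′ + 1`, signs
-- read as ±1. This is 3 = 0 for the same class, and 1 or -1 for any other.
plane-transversal : ∀ κ κ′ → κ ≢ κ′ → ∀ c m n n′ →
  ℓ κ′ (planeI κ c m n) (planeJ κ c m n) n ≡ ℓ κ′ (planeI κ c m n′) (planeJ κ c m n′) n′ → n ≡ n′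
plane-transversal = from-yes (∀₂? λ κ → ∀₂? λ κ′ → ¬? (κ ≟ᶜ κ′) →-dec
  ∀₃? λ c → ∀₃? λ m → ∀₃? λ n → ∀₃? λ n′ →
  (ℓ κ′ (planeI κ c m n) (planeJ κ c m n) n ≟₃ ℓ κ′ (planeI κ c m n′) (planeJ κ c m n′) n′)
  →-dec (n ≟₃ n′))

plane-injective : ∀ κ c m m′ n → planeI κ c m n ≡ planeI κ c m′ n → m ≡ m′
plane-injective = from-yes (∀₂? λ κ → ∀₃? λ c → ∀₃? λ m → ∀₃? λ m′ → ∀₃? λ n →
  (planeI κ c m n ≟₃ planeI κ c m′ n) →-dec (m ≟₃ m′))

-- Four distinct classes exhaust all classes

classIndex : Class → Fin 4
classIndex (false , false) = f0
classIndex (false , true) = fs f0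
classIndex (true , false) = fs (fs f0)
classIndex (true , true) = fs (fs (fs f0))

classIndex-injective : ∀ κ κ′ → classIndex κ ≡ classIndex κ′ → κ ≡ κ′
classIndex-injective =
  from-yes (∀₂? λ κ → ∀₂? λ κ′ → (classIndex κ Fin.≟ classIndex κ′) →-dec (κ ≟ᶜ κ′))

four-distinct⇒all : (f : Fin 4 → Class) → Injective _≡_ _≡_ f → ∀ κ → ∃[ X ] f X ≡ κ
four-distinct⇒all f inj κ with Fin.any? (λ X → f X ≟ᶜ κ)
... | yes hit = hit
... | no miss = contradiction (Fin.injective⇒≤ shrink-injective) ℕ.1+n≰n
  where
  missed : ∀ X → classIndex κ ≢ classIndex (f X)
  missed X eq = miss (X , sym (classIndex-injective _ _ eq))
  shrink : Fin 4 → Fin 3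
  shrink X = punchOut (missed X)
  shrink-injective : Injective _≡_ _≡_ shrink
  shrink-injective {X} {Y} eq =
    inj (classIndex-injective _ _ (Fin.punchOut-injective (missed X) (missed Y) eq))

-- The four components of a vector of V₈

comp : Fin 4 → V8 → B2
comp f0 = compA
comp (fs f0) = compB
comp (fs (fs f0)) = compC
comp (fs (fs (fs f0))) = compD

PV : Fin 4 → V8 → Set
PV f0 = PVa
PV (fs f0) = PVb
PV (fs (fs f0)) = PVc
PV (fs (fs (fs f0))) = PVd

ζ : Fin 4 → B2 → B2
ζ f0 = ζa
ζ (fs f0) = ζb
ζ (fs (fs f0)) = ζc
ζ (fs (fs (fs f0))) = ζd

0₂ : B2
0₂ = (false , false)

build : (Fin 4 → B2) → V8
build f = mk (f f0) (f (fs f0)) (f (fs (fs f0))) (f (fs (fs (fs f0))))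

comp-build : ∀ f X → comp X (build f) ≡ f X
comp-build f f0 = refl
comp-build f (fs f0) = refl
comp-build f (fs (fs f0)) = refl
comp-build f (fs (fs (fs f0))) = refl

build-comp : ∀ v → build (λ X → comp X v) ≡ v
build-comp (_ ∷ _ ∷ _ ∷ _ ∷ _ ∷ _ ∷ _ ∷ _ ∷ []) = refl

build-cong : ∀ {f g} → (∀ X → f X ≡ g X) → build f ≡ build g
build-cong f≡g rewrite f≡g f0 | f≡g (fs f0) | f≡g (fs (fs f0)) | f≡g (fs (fs (fs f0))) = refl

comp-ext : ∀ {v w} → (∀ X → comp X v ≡ comp X w) → v ≡ w
comp-ext {v} {w} eq = trans (sym (build-comp v)) (trans (build-cong eq) (build-comp w))

comp-⊕ : ∀ X v w → comp X (v ⊕ w) ≡ comp X v ⊕₂ comp X w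
comp-⊕ X (_ ∷ _ ∷ _ ∷ _ ∷ _ ∷ _ ∷ _ ∷ _ ∷ []) (_ ∷ _ ∷ _ ∷ _ ∷ _ ∷ _ ∷ _ ∷ _ ∷ []) with X
... | f0 = refl
... | fs f0 = refl
... | fs (fs f0) = refl
... | fs (fs (fs f0)) = refl

Ω₄⇒NZ : ∀ v → Ω₄ v → ∀ X → NZ (comp X v)
Ω₄⇒NZ v (a , b , c , d) f0 = a
Ω₄⇒NZ v (a , b , c , d) (fs f0) = b
Ω₄⇒NZ v (a , b , c , d) (fs (fs f0)) = c
Ω₄⇒NZ v (a , b , c , d) (fs (fs (fs f0))) = d

only : Fin 4 → B2 → Fin 4 → B2
only X b Y = if does (X Fin.≟ Y) then b else 0₂

place : Fin 4 → B2 → V8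
place X b = build (only X b)

comp-place : ∀ X b → comp X (place X b) ≡ b
comp-place X b = trans (comp-build (only X b) X)
  (cong (λ t → if t then b else 0₂) (dec-true (X Fin.≟ X) refl))

comp-place-≢ : ∀ {X Y} b → Y ≢ X → comp Y (place X b) ≡ 0₂
comp-place-≢ {X} {Y} b Y≢X = trans (comp-build (only X b) Y)
  (cong (λ t → if t then b else 0₂) (dec-false (X Fin.≟ Y) (Y≢X ∘ sym)))

place∈PV : ∀ X b → NZ b → PV X (place X b)
place∈PV f0 b nz = nz , refl , refl , refl
place∈PV (fs f0) b nz = refl , nz , refl , refl
place∈PV (fs (fs f0)) b nz = refl , refl , nz , refl
place∈PV (fs (fs (fs f0))) b nz = refl , refl , refl , nz

PV⇒place : ∀ X v → PV X v → NZ (comp X v) × v ≡ place X (comp X v)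
PV⇒place f0 (_ ∷ _ ∷ _ ∷ _ ∷ _ ∷ _ ∷ _ ∷ _ ∷ []) (nz , refl , refl , refl) = nz , refl
PV⇒place (fs f0) (_ ∷ _ ∷ _ ∷ _ ∷ _ ∷ _ ∷ _ ∷ _ ∷ []) (refl , nz , refl , refl) = nz , refl
PV⇒place (fs (fs f0)) (_ ∷ _ ∷ _ ∷ _ ∷ _ ∷ _ ∷ _ ∷ _ ∷ []) (refl , refl , nz , refl) = nz , refl
PV⇒place (fs (fs (fs f0))) (_ ∷ _ ∷ _ ∷ _ ∷ _ ∷ _ ∷ _ ∷ _ ∷ []) (refl , refl , refl , nz) =
  nz , refl

-- e X i is the X-component of p_λ when λ has X-th coordinate i.
e : Fin 4 → F3 → B2
e X i = pow i (ζ X) (true , true)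

-- Inverse of `e X` on nonzero vectors. The zero vector is also sent to `o₀`, which is why `e-log`
-- assumes `NZ`.
log : Fin 4 → B2 → F3
log X b =
  if does (b ≟₂ e X o₁) then o₁ else if does (b ≟₂ e X o₂) then o₂ else o₀

e-NZ : ∀ X i → NZ (e X i)
e-NZ = from-yes (Fin.all? λ X → ∀₃? λ i → NZ? (e X i))

e-log : ∀ X b → NZ b → e X (log X b) ≡ b
e-log = from-yes (Fin.all? λ X → ∀₂? λ b → NZ? b →-dec (e X (log X b) ≟₂ b))

log-e : ∀ X i → log X (e X i) ≡ i
log-e = from-yes (Fin.all? λ X → ∀₃? λ i → log X (e X i) ≟₃ i)

e-injective : ∀ X {i j} → e X i ≡ e X j → i ≡ j
e-injective X {i} {j} eq = trans (sym (log-e X i)) (trans (cong (log X) eq) (log-e X j))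

⊕₂-self : ∀ b → b ⊕₂ b ≡ 0₂
⊕₂-self = from-yes (∀₂? λ b → (b ⊕₂ b) ≟₂ 0₂)

⊕₂-self₃ : ∀ b → (b ⊕₂ b) ⊕₂ b ≡ b
⊕₂-self₃ = from-yes (∀₂? λ b → ((b ⊕₂ b) ⊕₂ b) ≟₂ b)

⊕₂-distinct₃ : ∀ a b c → NZ a → NZ b → NZ c → a ≢ b → b ≢ c → a ≢ c → (a ⊕₂ b) ⊕₂ c ≡ 0₂
⊕₂-distinct₃ = from-yes (∀₂? λ a → ∀₂? λ b → ∀₂? λ c →
  NZ? a →-dec (NZ? b →-dec (NZ? c →-dec
  (¬? (a ≟₂ b) →-dec (¬? (b ≟₂ c) →-dec (¬? (a ≟₂ c) →-dec (((a ⊕₂ b) ⊕₂ c) ≟₂ 0₂)))))))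

NZ⇒≢0 : ∀ b → NZ b → b ≢ 0₂
NZ⇒≢0 _ () refl

comp-p : ∀ X ρ → comp X (p ρ) ≡ e X (lookup ρ X)
comp-p f0 (_ ∷ _ ∷ _ ∷ _ ∷ []) = refl
comp-p (fs f0) (_ ∷ _ ∷ _ ∷ _ ∷ []) = refl
comp-p (fs (fs f0)) (_ ∷ _ ∷ _ ∷ _ ∷ []) = refl
comp-p (fs (fs (fs f0))) (_ ∷ _ ∷ _ ∷ _ ∷ []) = refl

-- Hamming distance

⟨_,_⟩ : F34 → F34 → F3
⟨ x₁ ∷ x₂ ∷ x₃ ∷ x₄ ∷ [] , y₁ ∷ y₂ ∷ y₃ ∷ y₄ ∷ [] ⟩ =
  (x₁ *₃ y₁) +₃ ((x₂ *₃ y₂) +₃ ((x₃ *₃ y₃) +₃ (x₄ *₃ y₄)))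

-- β₁, …, β₄ is orthonormal. Hence the weight of d with respect to it is congruent
-- to ⟨ d , d ⟩ mod 3, and so is the number of nonzero standard coordinates of d.
coords : F34 → F34
coords d = ⟨ β₁ , d ⟩ ∷ ⟨ β₂ , d ⟩ ∷ ⟨ β₃ , d ⟩ ∷ ⟨ β₄ , d ⟩ ∷ []

OneZeroAt : Fin 4 → F34 → Set
OneZeroAt X d = ∀ Y → Y ≢ X → lookup d Y ≢ o₀

oneZeroAt? : ∀ X d → Dec (OneZeroAt X d)
oneZeroAt? X d = Fin.all? λ Y → ¬? (Y Fin.≟ X) →-dec ¬? (lookup d Y ≟₃ o₀)

weight₃⁺ : ∀ X d → lookup d X ≡ o₀ → OneZeroAt X d →
           comb (coords d) ≡ d × nzCount (coords d) ≡ 3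
weight₃⁺ = from-yes (Fin.all? λ X → ∀₃₄? λ d → (lookup d X ≟₃ o₀) →-dec (oneZeroAt? X d →-dec
  (Vec.≡-dec _≟₃_ (comb (coords d)) d ×-dec (nzCount (coords d) ℕ.≟ 3))))

-- Since `comb c` is nonzero, the congruence mod 3 leaves exactly three nonzero standard coordinates
-- out of four; the zero at `X` is then the only one.
weight₃⁻ : ∀ X c → nzCount c ≡ 3 → lookup (comb c) X ≡ o₀ → OneZeroAt X (comb c)
weight₃⁻ = from-yes (Fin.all? λ X → ∀₃₄? λ c →
  (nzCount c ℕ.≟ 3) →-dec ((lookup (comb c) X ≟₃ o₀) →-dec oneZeroAt? X (comb c)))

difference-zero : ∀ x y → (x ≡ y → x +₃ (-₃ y) ≡ o₀) × (x +₃ (-₃ y) ≡ o₀ → x ≡ y)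
difference-zero = from-yes (∀₃? λ x → ∀₃? λ y →
  ((x ≟₃ y) →-dec ((x +₃ (-₃ y)) ≟₃ o₀)) ×-dec (((x +₃ (-₃ y)) ≟₃ o₀) →-dec (x ≟₃ y)))

lookup-difference : ∀ X ρ σ → lookup (ρ -v σ) X ≡ lookup ρ X +₃ (-₃ lookup σ X)
lookup-difference X ρ σ = Vec.lookup-zipWith (λ x y → x +₃ (-₃ y)) X ρ σ

-- Records the disagreement away from `X`; agreement at `X` is stated separately.
AgreeOnlyAt : Fin 4 → V8 → V8 → Set
AgreeOnlyAt X v w = ∀ Y → Y ≢ X → comp Y v ≢ comp Y w

HD3⁺ : ∀ X v w → (∀ Y → NZ (comp Y v)) → (∀ Y → NZ (comp Y w)) →
       comp X v ≡ comp X w → AgreeOnlyAt X v w → HD3 v w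
HD3⁺ X v w nzv nzw agree differ =
  λ′ v , λ′ w , p-λ′ v nzv , p-λ′ w nzw , coords d ,
  weight₃⁺ X d
    (trans (d≡ X) (proj₁ (difference-zero (log X (comp X v)) (log X (comp X w))) (cong (log X) agree)))
    (λ Y Y≢X d₀ → differ Y Y≢X
      (trans (sym (e-log Y _ (nzv Y)))
      (trans (cong (e Y) (proj₂ (difference-zero (log Y (comp Y v)) (log Y (comp Y w)))
                                   (trans (sym (d≡ Y)) d₀)))
             (e-log Y _ (nzw Y)))))
  where
  λ′ : V8 → F34
  λ′ v = tabulate λ Y → log Y (comp Y v)
  lookup-λ′ : ∀ v Y → lookup (λ′ v) Y ≡ log Y (comp Y v)
  lookup-λ′ v Y = Vec.lookup∘tabulate (λ Y → log Y (comp Y v)) Y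
  p-λ′ : ∀ v → (∀ Y → NZ (comp Y v)) → p (λ′ v) ≡ v
  p-λ′ v nz = comp-ext λ Y →
    trans (comp-p Y (λ′ v)) (trans (cong (e Y) (lookup-λ′ v Y)) (e-log Y _ (nz Y)))
  d = λ′ v -v λ′ w
  d≡ : ∀ Y → lookup d Y ≡ log Y (comp Y v) +₃ (-₃ log Y (comp Y w))
  d≡ Y = trans (lookup-difference Y (λ′ v) (λ′ w))
               (cong₂ (λ x y → x +₃ (-₃ y)) (lookup-λ′ v Y) (lookup-λ′ w Y))

HD3⁻ : ∀ X v w → HD3 v w → comp X v ≡ comp X w → AgreeOnlyAt X v w
HD3⁻ X v w (ρ , σ , refl , refl , c , comb≡ , wt) agree Y Y≢X eq =
  weight₃⁻ X c wt (zero-at X agree) Y Y≢X (zero-at Y eq)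
  where
  zero-at : ∀ Z → comp Z (p ρ) ≡ comp Z (p σ) → lookup (comb c) Z ≡ o₀
  zero-at Z eq = trans (cong (λ d → lookup d Z) comb≡) (trans (lookup-difference Z ρ σ)
    (proj₁ (difference-zero (lookup ρ Z) (lookup σ Z))
      (e-injective Z (trans (sym (comp-p Z ρ)) (trans eq (comp-p Z σ))))))

-- In component `X` a vector is added to itself three times, which returns it over F₂; in any other
-- component the three nonzero vectors of a plane are added, with sum zero.
troika-sum : ∀ X x y z → (∀ Y → NZ (comp Y x)) → (∀ Y → NZ (comp Y y)) → (∀ Y → NZ (comp Y z)) →
             comp X x ≡ comp X y → comp X x ≡ comp X z →
             AgreeOnlyAt X x y → AgreeOnlyAt X y z → AgreeOnlyAt X x z →
             (x ⊕ y) ⊕ z ≡ place X (comp X x)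
troika-sum X x y z nzx nzy nzz x≡y x≡z xy yz xz = comp-ext value
  where
  sum : ∀ Y → comp Y ((x ⊕ y) ⊕ z) ≡ (comp Y x ⊕₂ comp Y y) ⊕₂ comp Y z
  sum Y = trans (comp-⊕ Y (x ⊕ y) z) (cong (_⊕₂ comp Y z) (comp-⊕ Y x y))
  value : ∀ Y → comp Y ((x ⊕ y) ⊕ z) ≡ comp Y (place X (comp X x))
  value Y with Y Fin.≟ X
  ... | yes refl = trans (sum X) (trans
          (cong₂ (λ b c → (comp X x ⊕₂ b) ⊕₂ c) (sym x≡y) (sym x≡z))
          (trans (⊕₂-self₃ _) (sym (comp-place X _))))
  ... | no Y≢X = trans (sum Y) (trans
          (⊕₂-distinct₃ _ _ _ (nzx Y) (nzy Y) (nzz Y) (xy Y Y≢X) (yz Y Y≢X) (xz Y Y≢X))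
          (sym (comp-place-≢ _ Y≢X)))

-- Additive maps out of the tensor product

_⊕ₜ_ : Tensor3 → Tensor3 → Tensor3
_⊕ₜ_ = zipWith _xor_

pt : F3 → B2
pt = e f0

pure : F3 → F3 → F3 → Tensor3
pure i j k = pt i ⊗ pt j ⊗ pt k

-- The three nonzero vectors of V(2,2) sum to zero, so -₃ (i +₃ i′) is the index of pt i ⊕₂ pt i′.
pure-sum : ∀ i i′ → i ≢ i′ → ∀ j k →
  (pure i j k ⊕ₜ pure i′ j k ≡ pure (-₃ (i +₃ i′)) j k) ×
  (pure j i k ⊕ₜ pure j i′ k ≡ pure j (-₃ (i +₃ i′)) k) ×
  (pure j k i ⊕ₜ pure j k i′ ≡ pure j k (-₃ (i +₃ i′)))
pure-sum = from-yes (∀₃? λ i → ∀₃? λ i′ → ¬? (i ≟₃ i′) →-dec ∀₃? λ j → ∀₃? λ k →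
  ((pure i j k ⊕ₜ pure i′ j k) ≟₈ pure (-₃ (i +₃ i′)) j k) ×-dec
  (((pure j i k ⊕ₜ pure j i′ k) ≟₈ pure j (-₃ (i +₃ i′)) k) ×-dec
  ((pure j k i ⊕ₜ pure j k i′) ≟₈ pure j k (-₃ (i +₃ i′)))))

pure-injective : ∀ i j k i′ j′ k′ → pure i j k ≡ pure i′ j′ k′ → i ≡ i′ × j ≡ j′ × k ≡ k′
pure-injective = from-yes (∀₃? λ i → ∀₃? λ j → ∀₃? λ k → ∀₃? λ i′ → ∀₃? λ j′ → ∀₃? λ k′ →
  (pure i j k ≟₈ pure i′ j′ k′) →-dec ((i ≟₃ i′) ×-dec ((j ≟₃ j′) ×-dec (k ≟₃ k′))))

pureSum : List (F3 × F3 × F3) → Tensor3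
pureSum [] = 𝟘
pureSum ((i , j , k) ∷ xs) = pure i j k ⊕ₜ pureSum xs

-- pt o₁ and pt o₂ are the standard basis vectors (1,0) and (0,1).
support : Tensor3 → List (F3 × F3 × F3)
support (a ∷ b ∷ c ∷ d ∷ a′ ∷ b′ ∷ c′ ∷ d′ ∷ []) =
  term a o₁ o₁ o₁ ++ term b o₁ o₁ o₂ ++ term c o₁ o₂ o₁ ++ term d o₁ o₂ o₂ ++
  term a′ o₂ o₁ o₁ ++ term b′ o₂ o₁ o₂ ++ term c′ o₂ o₂ o₁ ++ term d′ o₂ o₂ o₂
  where
  term : Bool → F3 → F3 → F3 → List (F3 × F3 × F3)
  term t i j k = if t then (i , j , k) ∷ [] else []

pureSum-support : ∀ t → pureSum (support t) ≡ t
pureSum-support (a ∷ b ∷ c ∷ d ∷ a′ ∷ b′ ∷ c′ ∷ d′ ∷ []) =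
  from-yes (∀ᵇ? λ a → ∀ᵇ? λ b → ∀ᵇ? λ c → ∀ᵇ? λ d →
            ∀ᵇ? λ a′ → ∀ᵇ? λ b′ → ∀ᵇ? λ c′ → ∀ᵇ? λ d′ →
            let t = a ∷ b ∷ c ∷ d ∷ a′ ∷ b′ ∷ c′ ∷ d′ ∷ [] in pureSum (support t) ≟₈ t)
    a b c d a′ b′ c′ d′

Additive : (Tensor3 → B2) → Set
Additive f = ∀ s t → f (s ⊕ₜ t) ≡ f s ⊕₂ f t

additive-𝟘 : ∀ f → Additive f → f 𝟘 ≡ 0₂
additive-𝟘 f add = trans (add 𝟘 𝟘) (⊕₂-self (f 𝟘))

-- The pure tensors span: each tensor is the sum of the basis tensors listed in its `support`.
additive-ext : ∀ f g → Additive f → Additive g →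
               (∀ i j k → f (pure i j k) ≡ g (pure i j k)) → ∀ t → f t ≡ g t
additive-ext f g f-add g-add f≡g t =
  subst (λ t → f t ≡ g t) (pureSum-support t) (on-sums (support t))
  where
  on-sums : ∀ xs → f (pureSum xs) ≡ g (pureSum xs)
  on-sums [] = trans (additive-𝟘 f f-add) (sym (additive-𝟘 g g-add))
  on-sums ((i , j , k) ∷ xs) = trans (f-add (pure i j k) (pureSum xs))
    (trans (cong₂ _⊕₂_ (f≡g i j k) (on-sums xs)) (sym (g-add (pure i j k) (pureSum xs))))

lin2-additive : ∀ a b x y → lin2 a b (x ⊕₂ y) ≡ lin2 a b x ⊕₂ lin2 a b y
lin2-additive = from-yes (∀₂? λ a → ∀₂? λ b → ∀₂? λ x → ∀₂? λ y →
  lin2 a b (x ⊕₂ y) ≟₂ (lin2 a b x ⊕₂ lin2 a b y))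

-- Every permutation of the three nonzero vectors of V(2,2) is linear.
affine-transfer : ∀ X Y r c r′ c′ →
  ∃[ a ] ∃[ b ] ∀ m → lin2 a b (e X (affine r c m)) ≡ e Y (affine r′ c′ m)
affine-transfer = from-yes (Fin.all? λ X → Fin.all? λ Y →
  ∀ᵇ? λ r → ∀₃? λ c → ∀ᵇ? λ r′ → ∀₃? λ c′ → ∃₂? λ a → ∃₂? λ b →
  ∀₃? λ m → lin2 a b (e X (affine r c m)) ≟₂ e Y (affine r′ c′ m))

-- Three-way case distinctions and index pairs

bool-ext : ∀ {a b} → (a ≡ true → b ≡ true) → (b ≡ true → a ≡ true) → a ≡ b
bool-ext {false} {false} _ _ = refl
bool-ext {false} {true} _ g = g refl
bool-ext {true} f _ = sym (f refl)

∨₃⁻ : ∀ a b c → (a ∨ b ∨ c) ≡ true → a ≡ true ⊎ b ≡ true ⊎ c ≡ true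
∨₃⁻ true b c _ = inj₁ refl
∨₃⁻ false true c _ = inj₂ (inj₁ refl)
∨₃⁻ false false c on = inj₂ (inj₂ on)

∨₃⁺ : ∀ (f : F3 → Bool) m → f m ≡ true → (f o₀ ∨ f o₁ ∨ f o₂) ≡ true
∨₃⁺ f o₀ on rewrite on = refl
∨₃⁺ f o₁ on rewrite on = Bool.∨-zeroʳ (f o₀)
∨₃⁺ f o₂ on rewrite on | Bool.∨-zeroʳ (f o₁) = Bool.∨-zeroʳ (f o₀)

pick₃ : (P : F3 → Set) → ∀ m → P m → P o₀ ⊎ P o₁ ⊎ P o₂
pick₃ P o₀ x = inj₁ x
pick₃ P o₁ x = inj₂ (inj₁ x)
pick₃ P o₂ x = inj₂ (inj₂ x)

unpick₃ : (P : F3 → Set) → P o₀ ⊎ P o₁ ⊎ P o₂ → ∃ P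
unpick₃ P (inj₁ x) = o₀ , x
unpick₃ P (inj₂ (inj₁ x)) = o₁ , x
unpick₃ P (inj₂ (inj₂ x)) = o₂ , x

+₃-o₁-≢ : ∀ m → m +₃ o₁ ≢ m
+₃-o₁-≢ = from-yes (∀₃? λ m → ¬? ((m +₃ o₁) ≟₃ m))

does⇒ : {P : Set} (P? : Dec P) → does P? ≡ true → P
does⇒ (yes p) _ = p

-- Indexes the eight generators in the third direction other than the one over `(i , j)`.
pairsExcept : F3 → F3 → List (F3 × F3)
pairsExcept i j =
  filter (λ ij → ¬? (Product.≡-dec _≟₃_ _≟₃_ ij (i , j))) (cartesianProduct F3s F3s)

pairsExcept-length : ∀ i j → length (pairsExcept i j) ≡ 8
pairsExcept-length = from-yes (∀₃? λ i → ∀₃? λ j → length (pairsExcept i j) ℕ.≟ 8)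

∈-pairsExcept : ∀ i j i′ j′ → (i′ , j′) ≢ (i , j) → (i′ , j′) ∈ pairsExcept i j
∈-pairsExcept i j i′ j′ ≢ij = ∈.∈-filter⁺ (λ ij → ¬? (Product.≡-dec _≟₃_ _≟₃_ ij (i , j)))
  (∈.∈-cartesianProduct⁺ (∈-F3s i′) (∈-F3s j′)) ≢ij

-- The variety in coordinates

module Segre (φ : Tensor3 → V8) (iso : IsLinIso φ) (S⊆Ω₄ : ∀ v → InS φ v → Ω₄ v) where

  φ-add = proj₁ iso
  ψ = proj₁ (proj₂ iso)
  ψφ = proj₁ (proj₂ (proj₂ iso))
  φψ = proj₂ (proj₂ (proj₂ iso))

  q : F3 → F3 → F3 → V8
  q i j k = φ (pure i j k)

  q-injective : ∀ i j k i′ j′ k′ → q i j k ≡ q i′ j′ k′ → i ≡ i′ × j ≡ j′ × k ≡ k′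
  q-injective i j k i′ j′ k′ eq = pure-injective i j k i′ j′ k′
    (trans (sym (ψφ (pure i j k))) (trans (cong ψ eq) (ψφ (pure i′ j′ k′))))

  pt-log : ∀ x → NZ x → pt (log f0 x) ≡ x
  pt-log = e-log f0

  φ-log : ∀ x y z → NZ x → NZ y → NZ z → q (log f0 x) (log f0 y) (log f0 z) ≡ φ (x ⊗ y ⊗ z)
  φ-log x y z nx ny nz rewrite pt-log x nx | pt-log y ny | pt-log z nz = refl

  q∈S : ∀ i j k → InS φ (q i j k)
  q∈S i j k = pt i , pt j , pt k , e-NZ f0 i , e-NZ f0 j , e-NZ f0 k , refl

  S⇒q : ∀ {v} → InS φ v → ∃[ i ] ∃[ j ] ∃[ k ] q i j k ≡ v
  S⇒q (x , y , z , nx , ny , nz , eq) =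
    log f0 x , log f0 y , log f0 z , trans (φ-log x y z nx ny nz) eq

  S-NZ : ∀ v → InS φ v → ∀ X → NZ (comp X v)
  S-NZ v v∈S = Ω₄⇒NZ v (S⊆Ω₄ v v∈S)

  q-NZ : ∀ i j k X → NZ (comp X (q i j k))
  q-NZ i j k = S-NZ (q i j k) (q∈S i j k)

  g : Fin 4 → F3 → F3 → F3 → F3
  g X i j k = log X (comp X (q i j k))

  comp-q : ∀ X i j k → comp X (q i j k) ≡ e X (g X i j k)
  comp-q X i j k = sym (e-log X (comp X (q i j k)) (q-NZ i j k X))

  comp-φ-additive : ∀ X → Additive (comp X ∘ φ)
  comp-φ-additive X s t = trans (cong (comp X) (φ-add s t)) (comp-⊕ X (φ s) (φ t))

  -- Two points of a generator with the same X-component would add up to a point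
  -- of 𝒮 with X-component zero.
  collinear-≢ : ∀ X i j k i′ j′ k′ i″ j″ k″ →
                pure i j k ⊕ₜ pure i′ j′ k′ ≡ pure i″ j″ k″ → g X i j k ≢ g X i′ j′ k′
  collinear-≢ X i j k i′ j′ k′ i″ j″ k″ sum eq =
    NZ⇒≢0 (comp X (q i″ j″ k″)) (q-NZ i″ j″ k″ X)
      (trans (cong (comp X ∘ φ) (sym sum))
      (trans (comp-φ-additive X (pure i j k) (pure i′ j′ k′))
      (trans (cong₂ _⊕₂_ (comp-q X i j k) (trans (comp-q X i′ j′ k′) (cong (e X) (sym eq))))
             (⊕₂-self (e X (g X i j k))))))

  g-injective₁ : ∀ X j k → Injective _≡_ _≡_ (λ i → g X i j k)
  g-injective₁ X j k {i} {i′} eq with i ≟₃ i′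
  ... | yes i≡i′ = i≡i′
  ... | no i≢i′ = contradiction eq
    (collinear-≢ X i j k i′ j k (-₃ (i +₃ i′)) j k (proj₁ (pure-sum i i′ i≢i′ j k)))

  g-injective₂ : ∀ X i k → Injective _≡_ _≡_ (λ j → g X i j k)
  g-injective₂ X i k {j} {j′} eq with j ≟₃ j′
  ... | yes j≡j′ = j≡j′
  ... | no j≢j′ = contradiction eq
    (collinear-≢ X i j k i j′ k i (-₃ (j +₃ j′)) k (proj₁ (proj₂ (pure-sum j j′ j≢j′ i k))))

  g-injective₃ : ∀ X i j → Injective _≡_ _≡_ (g X i j)
  g-injective₃ X i j {k} {k′} eq with k ≟₃ k′
  ... | yes k≡k′ = k≡k′
  ... | no k≢k′ = contradiction eq
    (collinear-≢ X i j k i j k′ i j (-₃ (k +₃ k′)) (proj₂ (proj₂ (pure-sum k k′ k≢k′ i j))))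

  abstract
    -- Injectivity along all generators makes `g X` a Latin cube. The witnesses stay abstract: later
    -- arguments use only this equation.
    g-class : ∀ X → ∃[ κ ] ∃[ r ] ∃[ c ] ∀ i j k → g X i j k ≡ affine r c (ℓ κ i j k)
    g-class X = latin-cube-class (g X) (g-injective₁ X) (g-injective₂ X) (g-injective₃ X)

  class : Fin 4 → Class
  class X = proj₁ (g-class X)

  -- Converts the level of a plane in the class of `X` into the index of the `X`-component shared by
  -- its points.
  π : Fin 4 → F3 → F3
  π X = affine (proj₁ (proj₂ (g-class X))) (proj₁ (proj₂ (proj₂ (g-class X))))

  comp-q-class : ∀ X i j k → comp X (q i j k) ≡ e X (π X (ℓ (class X) i j k))
  comp-q-class X i j k =
    trans (comp-q X i j k) (cong (e X) (proj₂ (proj₂ (proj₂ (g-class X))) i j k))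

  e-π-injective : ∀ X {m m′} → e X (π X m) ≡ e X (π X m′) → m ≡ m′
  e-π-injective X = affine-injective (proj₁ (proj₂ (g-class X))) (proj₁ (proj₂ (proj₂ (g-class X)))) ∘ e-injective X

  π-surjective : ∀ X n → ∃[ m ] π X m ≡ n
  π-surjective X =
    affine-surjective (proj₁ (proj₂ (g-class X))) (proj₁ (proj₂ (proj₂ (g-class X))))

  -- A linear dependence on pure tensors extends to all tensors, hence to all of V₈ because `φ` is
  -- onto. It fails at a vector `v` whose only nonzero component is the one at `Y`.
  components-independent : ∀ X Y → X ≢ Y → ∀ a b →
                           ¬ (∀ i j k → comp Y (q i j k) ≡ lin2 a b (comp X (q i j k)))
  components-independent X Y X≢Y a b dependent = NZ⇒≢0 (e Y o₀) (e-NZ Y o₀) zero-comp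
    where
    L-additive : Additive (lin2 a b ∘ comp X ∘ φ)
    L-additive s t = trans (cong (lin2 a b) (comp-φ-additive X s t))
                           (lin2-additive a b (comp X (φ s)) (comp X (φ t)))
    v = place Y (e Y o₀)
    agree = additive-ext (comp Y ∘ φ) (lin2 a b ∘ comp X ∘ φ)
                         (comp-φ-additive Y) L-additive dependent
    zero-comp : e Y o₀ ≡ 0₂
    zero-comp = begin
      e Y o₀                       ≡⟨ comp-place Y (e Y o₀) ⟨
      comp Y v                     ≡⟨ cong (comp Y) (φψ v) ⟨
      comp Y (φ (ψ v))             ≡⟨ agree (ψ v) ⟩
      lin2 a b (comp X (φ (ψ v)))  ≡⟨ cong (lin2 a b ∘ comp X) (φψ v) ⟩
      lin2 a b (comp X v)          ≡⟨ cong (lin2 a b) (comp-place-≢ (e Y o₀) X≢Y) ⟩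
      0₂                           ∎
      where open ≡-Reasoning

  -- Both components are then relabellings of the same form `ℓ`, so a permutation of nonzero vectors
  -- carries one to the other, and such a permutation is linear.
  same-class⇒dependent : ∀ X Y → class X ≡ class Y →
    ∃[ a ] ∃[ b ] ∀ i j k → comp Y (q i j k) ≡ lin2 a b (comp X (q i j k))
  same-class⇒dependent X Y same =
    let a , b , transfer = affine-transfer X Y
          (proj₁ (proj₂ (g-class X))) (proj₁ (proj₂ (proj₂ (g-class X))))
          (proj₁ (proj₂ (g-class Y))) (proj₁ (proj₂ (proj₂ (g-class Y))))
    in a , b , λ i j k → begin
      comp Y (q i j k)                             ≡⟨ comp-q-class Y i j k ⟩
      e Y (π Y (ℓ (class Y) i j k))                ≡⟨ cong (λ κ → e Y (π Y (ℓ κ i j k))) same ⟨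
      e Y (π Y (ℓ (class X) i j k))                ≡⟨ transfer (ℓ (class X) i j k) ⟨
      lin2 a b (e X (π X (ℓ (class X) i j k)))     ≡⟨ cong (lin2 a b) (comp-q-class X i j k) ⟨
      lin2 a b (comp X (q i j k))                  ∎
    where open ≡-Reasoning

  class-injective : Injective _≡_ _≡_ class
  class-injective {X} {Y} same with X Fin.≟ Y
  ... | yes X≡Y = X≡Y
  ... | no X≢Y = let a , b , dependent = same-class⇒dependent X Y same
                 in contradiction dependent (components-independent X Y X≢Y a b)

  class-surjective : ∀ κ → ∃[ X ] class X ≡ κ
  class-surjective = four-distinct⇒all class class-injective

  -- Fans

  OnPlane : Class → F3 → V8 → Set
  OnPlane κ m v = ∃[ i ] ∃[ j ] ∃[ k ] q i j k ≡ v × ℓ κ i j k ≡ m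

  onPlane? : ∀ κ m v → Dec (OnPlane κ m v)
  onPlane? κ m v = ∃₃? λ i → ∃₃? λ j → ∃₃? λ k → (q i j k ≟₈ v) ×-dec (ℓ κ i j k ≟₃ m)

  fan : Class → F3 → V8 → Bool
  fan κ m v = does (onPlane? κ m v)

  fan⁺ : ∀ κ m i j k → ℓ κ i j k ≡ m → fan κ m (q i j k) ≡ true
  fan⁺ κ m i j k ℓ≡m = dec-true (onPlane? κ m (q i j k)) (i , j , k , refl , ℓ≡m)

  fan⁻ : ∀ κ m v → fan κ m v ≡ true → OnPlane κ m v
  fan⁻ κ m v = does⇒ (onPlane? κ m v)

  fan-q⁻ : ∀ κ m i j k → fan κ m (q i j k) ≡ true → ℓ κ i j k ≡ m
  fan-q⁻ κ m i j k on =
    let i′ , j′ , k′ , q≡ , ℓ≡m = fan⁻ κ m (q i j k) on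
        i≡ , j≡ , k≡ = q-injective i′ j′ k′ i j k q≡
    in subst (λ i → ℓ κ i j k ≡ m) i≡ (subst (λ j → ℓ κ i′ j k ≡ m) j≡
         (subst (λ k → ℓ κ i′ j′ k ≡ m) k≡ ℓ≡m))

  planePoint : Class → F3 → F3 → F3 → V8
  planePoint κ c m n = q (planeI κ c m n) (planeJ κ c m n) n

  planePoint-fan : ∀ κ c m n → fan κ c (planePoint κ c m n) ≡ true
  planePoint-fan κ c m n = fan⁺ κ c (planeI κ c m n) (planeJ κ c m n) n (ℓ-plane κ c m n)

  planePoint-complete : ∀ κ c v → fan κ c v ≡ true → ∃[ m ] ∃[ n ] v ≡ planePoint κ c m n
  planePoint-complete κ c v on with fan⁻ κ c v on
  ... | i , j , n , refl , refl =
    let m , I≡ , J≡ = plane-complete κ i j n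
    in m , n , sym (cong₂ (λ i j → q i j n) I≡ J≡)

  planePoint-injective : ∀ κ c m n m′ n′ → planePoint κ c m n ≡ planePoint κ c m′ n′ →
                         m ≡ m′ × n ≡ n′
  planePoint-injective κ c m n m′ n′ eq =
    let I≡ , _ , n≡ = q-injective (planeI κ c m n) (planeJ κ c m n) n
                                  (planeI κ c m′ n′) (planeJ κ c m′ n′) n′ eq
    in plane-injective κ c m m′ n (trans I≡ (cong (planeI κ c m′) (sym n≡))) , n≡

  planePoints : Class → F3 → List V8
  planePoints κ c = map (uncurry (planePoint κ c)) (cartesianProduct F3s F3s)

  fan-card : ∀ κ c → card (fan κ c) ≡ 9
  fan-card κ c = card-≡ (fan κ c) {planePoints κ c}
    (Unique.map⁺ (λ { {m , n} {m′ , n′} eq →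
       let m≡ , n≡ = planePoint-injective κ c m n m′ n′ eq in cong₂ _,_ m≡ n≡ })
                 (Unique.cartesianProduct⁺ F3s-unique F3s-unique))
    listed
    onFan
    where
    listed : ∀ v → fan κ c v ≡ true → v ∈ planePoints κ c
    listed v on with planePoint-complete κ c v on
    ... | m , n , refl = ∈.∈-map⁺ (uncurry (planePoint κ c))
                           (∈.∈-cartesianProduct⁺ (∈-F3s m) (∈-F3s n))
    onFan : ∀ {v} → v ∈ planePoints κ c → fan κ c v ≡ true
    onFan v∈ with ∈.∈-map⁻ (uncurry (planePoint κ c)) v∈
    ... | (m , n) , _ , refl = planePoint-fan κ c m n

  fan⊆S : ∀ κ c v → fan κ c v ≡ true → InS φ v
  fan⊆S κ c v on with fan⁻ κ c v on
  ... | i , j , k , refl , _ = q∈S i j k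

  φ-fan : ∀ κ c x y z → NZ x → NZ y → NZ z → ∀ v → φ (x ⊗ y ⊗ z) ≡ v → fan κ c v ≡ true →
          ℓ κ (log f0 x) (log f0 y) (log f0 z) ≡ c
  φ-fan κ c x y z nx ny nz v eq on = fan-q⁻ κ c (log f0 x) (log f0 y) (log f0 z)
    (subst (λ v → fan κ c v ≡ true) (sym (trans (φ-log x y z nx ny nz) eq)) on)

  log-injective : ∀ x x′ → NZ x → NZ x′ → log f0 x ≡ log f0 x′ → x ≡ x′
  log-injective x x′ nx nx′ eq = trans (sym (pt-log x nx)) (trans (cong pt eq) (pt-log x′ nx′))

  fan-generator : ∀ κ c v w → fan κ c v ≡ true → fan κ c w ≡ true → CommonGen φ v w → v ≡ w
  fan-generator κ c v w vF wF (f0 , s , t , ns , nt , (x , nx , x↦) , (x′ , nx′ , x′↦)) =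
    trans (sym x↦) (trans (cong (λ x → φ (x ⊗ s ⊗ t)) (log-injective x x′ nx nx′
      (proj₁ (ℓ-injective κ (log f0 x) (log f0 s) (log f0 t) (log f0 x′) (log f0 s) (log f0 t)
        (trans (φ-fan κ c x s t nx ns nt v x↦ vF) (sym (φ-fan κ c x′ s t nx′ ns nt w x′↦ wF))))
        refl refl))) x′↦)
  fan-generator κ c v w vF wF (fs f0 , s , t , ns , nt , (x , nx , x↦) , (x′ , nx′ , x′↦)) =
    trans (sym x↦) (trans (cong (λ x → φ (s ⊗ x ⊗ t)) (log-injective x x′ nx nx′
      (proj₁ (proj₂ (ℓ-injective κ (log f0 s) (log f0 x) (log f0 t) (log f0 s) (log f0 x′) (log f0 t)
        (trans (φ-fan κ c s x t ns nx nt v x↦ vF) (sym (φ-fan κ c s x′ t ns nx′ nt w x′↦ wF)))))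
        refl refl))) x′↦)
  fan-generator κ c v w vF wF (fs (fs f0) , s , t , ns , nt , (x , nx , x↦) , (x′ , nx′ , x′↦)) =
    trans (sym x↦) (trans (cong (λ x → φ (s ⊗ t ⊗ x)) (log-injective x x′ nx nx′
      (proj₂ (proj₂ (ℓ-injective κ (log f0 s) (log f0 t) (log f0 x) (log f0 s) (log f0 t) (log f0 x′)
        (trans (φ-fan κ c s t x ns nt nx v x↦ vF) (sym (φ-fan κ c s t x′ ns nt nx′ w x′↦ wF)))))
        refl refl))) x′↦)

  fan-isFan : ∀ κ c → IsFan φ (fan κ c)
  fan-isFan κ c = fan⊆S κ c , fan-card κ c ,
    λ v w vF wF v≢w gen → v≢w (fan-generator κ c v w vF wF gen)

  -- Every fan is a plane of the cube

  module FanClass (F : V8 → Bool) (F-fan : IsFan φ F) where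

    F⊆S = proj₁ F-fan
    F-generator = proj₂ (proj₂ F-fan)

    unique₁ : ∀ i i′ j k → F (q i j k) ≡ true → F (q i′ j k) ≡ true → i ≡ i′
    unique₁ i i′ j k on on′ with i ≟₃ i′
    ... | yes i≡i′ = i≡i′
    ... | no i≢i′ = contradiction
      (f0 , pt j , pt k , e-NZ f0 j , e-NZ f0 k ,
       (pt i , e-NZ f0 i , refl) , (pt i′ , e-NZ f0 i′ , refl))
      (F-generator (q i j k) (q i′ j k) on on′ (λ eq → i≢i′ (proj₁ (q-injective i j k i′ j k eq))))

    unique₂ : ∀ i j j′ k → F (q i j k) ≡ true → F (q i j′ k) ≡ true → j ≡ j′
    unique₂ i j j′ k on on′ with j ≟₃ j′
    ... | yes j≡j′ = j≡j′
    ... | no j≢j′ = contradiction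
      (fs f0 , pt i , pt k , e-NZ f0 i , e-NZ f0 k ,
       (pt j , e-NZ f0 j , refl) , (pt j′ , e-NZ f0 j′ , refl))
      (F-generator (q i j k) (q i j′ k) on on′ (λ eq → j≢j′ (proj₁ (proj₂ (q-injective i j k i j′ k eq)))))

    unique₃ : ∀ i j k k′ → F (q i j k) ≡ true → F (q i j k′) ≡ true → k ≡ k′
    unique₃ i j k k′ on on′ with k ≟₃ k′
    ... | yes k≡k′ = k≡k′
    ... | no k≢k′ = contradiction
      (fs (fs f0) , pt i , pt j , e-NZ f0 i , e-NZ f0 j ,
       (pt k , e-NZ f0 k , refl) , (pt k′ , e-NZ f0 k′ , refl))
      (F-generator (q i j k) (q i j k′) on on′ (λ eq → k≢k′ (proj₂ (proj₂ (q-injective i j k i j k′ eq)))))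

    hit? : ∀ i j → Dec (∃[ k ] F (q i j k) ≡ true)
    hit? i j = ∃₃? λ k → F (q i j k) Bool.≟ true

    hitPoint : ∀ i j → Dec (∃[ k ] F (q i j k) ≡ true) → V8
    hitPoint i j (yes (k , _)) = q i j k
    -- A dummy value: `hitPoint≡` concerns only lines that meet `F`.
    hitPoint i j (no _) = 𝟘

    hitPoint≡ : ∀ i j k → F (q i j k) ≡ true → ∀ found → hitPoint i j found ≡ q i j k
    hitPoint≡ i j k on (yes (k′ , on′)) = cong (q i j) (unique₃ i j k′ k on′ on)
    hitPoint≡ i j k on (no none) = contradiction (k , on) none

    point : F3 × F3 → V8
    point (i , j) = hitPoint i j (hit? i j)

    -- The nine points of F lie on distinct lines q i j (-), hence on all nine of them.
    ¬missed : ∀ i j → ¬ ¬ (∃[ k ] F (q i j k) ≡ true)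
    ¬missed i j missed = contradiction nine≤eight ℕ.1+n≰n
      where
      F⊆others : ∀ {v} → v ∈ members F → v ∈ map point (pairsExcept i j)
      F⊆others {v} v∈ =
        let on = ∈-members⁻ F v∈
            i′ , j′ , k′ , q≡v = S⇒q (F⊆S v on)
            on′ = subst (λ v → F v ≡ true) (sym q≡v) on
            off : (i′ , j′) ≢ (i , j)
            off eq = missed (k′ , subst (λ (i , j) → F (q i j k′) ≡ true) eq on′)
        in subst (_∈ map point (pairsExcept i j))
             (trans (hitPoint≡ i′ j′ k′ on′ (hit? i′ j′)) q≡v)
             (∈.∈-map⁺ point (∈-pairsExcept i j i′ j′ off))
      nine≤eight : 9 ≤ 8
      nine≤eight = subst₂ _≤_ (proj₁ (proj₂ F-fan))
        (trans (length-map point (pairsExcept i j)) (pairsExcept-length i j))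
        (Unique-⊆⇒length≤ (members-unique F) F⊆others)

    hit : ∀ i j → ∃[ k ] F (q i j k) ≡ true
    hit i j = decidable-stable (hit? i j) (¬missed i j)

    h : F3 → F3 → F3
    h i j = proj₁ (hit i j)

    h-on : ∀ i j → F (q i j (h i j)) ≡ true
    h-on i j = proj₂ (hit i j)

    h-injective₂ : ∀ i → Injective _≡_ _≡_ (h i)
    h-injective₂ i {j} {j′} eq = unique₂ i j j′ (h i j) (h-on i j)
      (subst (λ k → F (q i j′ k) ≡ true) (sym eq) (h-on i j′))

    h-injective₁ : ∀ j → Injective _≡_ _≡_ (λ i → h i j)
    h-injective₁ j {i} {i′} eq = unique₁ i i′ j (h i j) (h-on i j)
      (subst (λ k → F (q i′ j k) ≡ true) (sym eq) (h-on i′ j))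

    -- `F` is the graph of `h`, and `h` is a Latin square because `F` meets no generator twice.
    classify : ∃[ κ ] ∃[ m ] F ≐ fan κ m
    classify =
      let s , t , c , h≡ = latin-square h h-injective₂ h-injective₁
          κ , graph = ℓ-graph s t
          F⇒fan : ∀ v → F v ≡ true → fan κ c v ≡ true
          F⇒fan v on = let i , j , k , q≡v = S⇒q (F⊆S v on) in
            subst (λ v → fan κ c v ≡ true) q≡v (fan⁺ κ c i j k (proj₁ (graph c i j k)
              (trans (unique₃ i j k (h i j)
                       (subst (λ v → F v ≡ true) (sym q≡v) on) (h-on i j)) (h≡ i j))))
          fan⇒F : ∀ v → fan κ c v ≡ true → F v ≡ true
          fan⇒F v on = let i , j , k , q≡v , ℓ≡c = fan⁻ κ c v on in
            subst (λ v → F v ≡ true) q≡v (subst (λ k → F (q i j k) ≡ true)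
              (trans (h≡ i j) (sym (proj₂ (graph c i j k) ℓ≡c))) (h-on i j))
      in κ , c , λ v → bool-ext (F⇒fan v) (fan⇒F v)

  -- Triplets of fans are parallel classes of planes

  triplet : Class → Triplet φ
  triplet κ = record
    { F₁ = fan κ o₀ ; F₂ = fan κ o₁ ; F₃ = fan κ o₂
    ; fan₁ = fan-isFan κ o₀ ; fan₂ = fan-isFan κ o₁ ; fan₃ = fan-isFan κ o₂
    ; union = λ v → mk⇔
        (λ on → [ fan⊆S κ o₀ v , [ fan⊆S κ o₁ v , fan⊆S κ o₂ v ]′ ]′
                  (∨₃⁻ (fan κ o₀ v) (fan κ o₁ v) (fan κ o₂ v) on))
        (λ v∈S → let i , j , k , q≡v = S⇒q v∈S in
          subst (λ v → (fan κ o₀ v ∨ fan κ o₁ v ∨ fan κ o₂ v) ≡ true) q≡v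
            (∨₃⁺ (λ m → fan κ m (q i j k)) (ℓ κ i j k) (fan⁺ κ (ℓ κ i j k) i j k refl)))
    }

  same-class-triplet : ∀ T κ₁ κ₂ κ₃ m₁ m₂ m₃ →
                      F₁ T ≐ fan κ₁ m₁ → F₂ T ≐ fan κ₂ m₂ → F₃ T ≐ fan κ₃ m₃ →
                      SameTriplet T (triplet κ₃)
  same-class-triplet T κ₁ κ₂ κ₃ m₁ m₂ m₃ F₁≐ F₂≐ F₃≐ =
    assemble (ℓ-cover κ₁ κ₂ κ₃ m₁ m₂ m₃ cover)
    where
    onLevel : ∀ F κ m → F ≐ fan κ m → ∀ i j k → F (q i j k) ≡ true → ℓ κ i j k ≡ m
    onLevel F κ m F≐ i j k on = fan-q⁻ κ m i j k (trans (sym (F≐ (q i j k))) on)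
    cover : ∀ i j k → ℓ κ₁ i j k ≡ m₁ ⊎ ℓ κ₂ i j k ≡ m₂ ⊎ ℓ κ₃ i j k ≡ m₃
    cover i j k = Sum.map (onLevel (F₁ T) κ₁ m₁ F₁≐ i j k)
      (Sum.map (onLevel (F₂ T) κ₂ m₂ F₂≐ i j k) (onLevel (F₃ T) κ₃ m₃ F₃≐ i j k))
      (∨₃⁻ (F₁ T (q i j k)) (F₂ T (q i j k)) (F₃ T (q i j k))
           (from (union T (q i j k)) (q∈S i j k)))
    assemble : κ₁ ≡ κ₂ × κ₂ ≡ κ₃ × (∀ m → m ≡ m₁ ⊎ m ≡ m₂ ⊎ m ≡ m₃) →
               SameTriplet T (triplet κ₃)
    assemble (refl , refl , ms) =
      pick₃ (λ m → F₁ T ≐ fan κ₃ m) m₁ F₁≐ ,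
      pick₃ (λ m → F₂ T ≐ fan κ₃ m) m₂ F₂≐ ,
      pick₃ (λ m → F₃ T ≐ fan κ₃ m) m₃ F₃≐ ,
      found o₀ (ms o₀) , found o₁ (ms o₁) , found o₂ (ms o₂)
      where
      found : ∀ m → m ≡ m₁ ⊎ m ≡ m₂ ⊎ m ≡ m₃ →
              fan κ₃ m ≐ F₁ T ⊎ fan κ₃ m ≐ F₂ T ⊎ fan κ₃ m ≐ F₃ T
      found m (inj₁ refl) = inj₁ (λ v → sym (F₁≐ v))
      found m (inj₂ (inj₁ refl)) = inj₂ (inj₁ (λ v → sym (F₂≐ v)))
      found m (inj₂ (inj₂ refl)) = inj₂ (inj₂ (λ v → sym (F₃≐ v)))

  triplet-complete : ∀ T → ∃[ κ ] SameTriplet T (triplet κ)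
  triplet-complete T = gather (FanClass.classify (F₁ T) (fan₁ T))
                              (FanClass.classify (F₂ T) (fan₂ T))
                              (FanClass.classify (F₃ T) (fan₃ T))
    where
    gather : (∃[ κ ] ∃[ m ] F₁ T ≐ fan κ m) → (∃[ κ ] ∃[ m ] F₂ T ≐ fan κ m) →
             (∃[ κ ] ∃[ m ] F₃ T ≐ fan κ m) → ∃[ κ ] SameTriplet T (triplet κ)
    gather (κ₁ , m₁ , F₁≐) (κ₂ , m₂ , F₂≐) (κ₃ , m₃ , F₃≐) =
      κ₃ , same-class-triplet T κ₁ κ₂ κ₃ m₁ m₂ m₃ F₁≐ F₂≐ F₃≐

  fan-class-unique : ∀ κ κ′ → κ ≢ κ′ → ∀ m m′ → ¬ (fan κ m ≐ fan κ′ m′)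
  fan-class-unique κ κ′ κ≢κ′ m m′ same =
    -- The level `m′ +₃ o₁` differs from `m′`, so this point lies on the first plane but off the
    -- second.
    let i , j , k , ℓ≡m , ℓ′≡ = ℓ-independent κ κ′ κ≢κ′ m (m′ +₃ o₁)
    in +₃-o₁-≢ m′ (trans (sym ℓ′≡)
         (fan-q⁻ κ′ m′ i j k (trans (sym (same (q i j k))) (fan⁺ κ m i j k ℓ≡m))))

  triplet-distinct : ∀ X Y → X ≢ Y → ¬ SameTriplet (triplet (class X)) (triplet (class Y))
  triplet-distinct X Y X≢Y (first , _) =
    [ apart o₀ , [ apart o₁ , apart o₂ ]′ ]′ first
    where
    apart : ∀ m → ¬ (fan (class X) o₀ ≐ fan (class Y) m)
    apart = fan-class-unique (class X) (class Y) (X≢Y ∘ class-injective) o₀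

  -- Centres

  centre : Fin 4 → F3 → V8
  centre X m = place X (e X (π X m))

  comp-fan : ∀ X m v → fan (class X) m v ≡ true → comp X v ≡ e X (π X m)
  comp-fan X m v on =
    let i , j , k , q≡v , ℓ≡m = fan⁻ (class X) m v on
    in trans (cong (comp X) (sym q≡v)) (trans (comp-q-class X i j k) (cong (e X ∘ π X) ℓ≡m))

  -- All points of the fan share their `X`-component, so Hamming distance 3 makes the other
  -- components differ. The troika is arbitrary, which gives uniqueness of the centre as well as its
  -- value.
  fan-troika-sum : ∀ X m x y z → (∀ v → v ≡ x ⊎ v ≡ y ⊎ v ≡ z → fan (class X) m v ≡ true) →
                   HD3 x y → HD3 y z → HD3 x z → (x ⊕ y) ⊕ z ≡ centre X m
  fan-troika-sum X m x y z on xy yz xz =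
    trans (troika-sum X x y z (nz x x∈) (nz y y∈) (nz z z∈) x≡y x≡z
            (HD3⁻ X x y xy x≡y) (HD3⁻ X y z yz (trans (sym x≡y) x≡z)) (HD3⁻ X x z xz x≡z))
          (cong (place X) (comp-fan X m x x∈))
    where
    x∈ = on x (inj₁ refl)
    y∈ = on y (inj₂ (inj₁ refl))
    z∈ = on z (inj₂ (inj₂ refl))
    nz : ∀ v → fan (class X) m v ≡ true → ∀ Y → NZ (comp Y v)
    nz v v∈ = S-NZ v (fan⊆S (class X) m v v∈)
    x≡y = trans (comp-fan X m x x∈) (sym (comp-fan X m y y∈))
    x≡z = trans (comp-fan X m x x∈) (sym (comp-fan X m z z∈))

  -- On a line of direction `(s , t , 1)` the `X`-component is constant, and every other component
  -- changes by `plane-transversal`, its class being different.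
  planePoint-HD3 : ∀ X c m n n′ → n ≢ n′ →
                   HD3 (planePoint (class X) c m n) (planePoint (class X) c m n′)
  planePoint-HD3 X c m n n′ n≢n′ = HD3⁺ X (P n) (P n′) (nz n) (nz n′)
    (trans (comp-fan X c (P n) (planePoint-fan κ c m n))
           (sym (comp-fan X c (P n′) (planePoint-fan κ c m n′))))
    differ
    where
    κ = class X
    P = planePoint κ c m
    nz : ∀ n Y → NZ (comp Y (P n))
    nz n = q-NZ (planeI κ c m n) (planeJ κ c m n) n
    differ : AgreeOnlyAt X (P n) (P n′)
    differ Y Y≢X eq = n≢n′ (plane-transversal κ (class Y) (Y≢X ∘ sym ∘ class-injective) c m n n′
      (e-π-injective Y (trans (sym (comp-q-class Y (planeI κ c m n) (planeJ κ c m n) n))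
        (trans eq (comp-q-class Y (planeI κ c m n′) (planeJ κ c m n′) n′)))))

  planePoint-troika : ∀ X c m →
    IsTroikaWithCentre φ (planePoint (class X) c m o₀) (planePoint (class X) c m o₁)
                         (planePoint (class X) c m o₂) (centre X c)
  planePoint-troika X c m =
    inS o₀ , inS o₁ , inS o₂ , h₀₁ , h₁₂ , h₀₂ ,
    fan-troika-sum X c (P o₀) (P o₁) (P o₂)
      (λ { v (inj₁ refl) → planePoint-fan (class X) c m o₀
         ; v (inj₂ (inj₁ refl)) → planePoint-fan (class X) c m o₁
         ; v (inj₂ (inj₂ refl)) → planePoint-fan (class X) c m o₂ }) h₀₁ h₁₂ h₀₂
    where
    P = planePoint (class X) c m
    inS : ∀ n → InS φ (P n)
    inS n = q∈S (planeI (class X) c m n) (planeJ (class X) c m n) n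
    h₀₁ = planePoint-HD3 X c m o₀ o₁ λ ()
    h₁₂ = planePoint-HD3 X c m o₁ o₂ λ ()
    h₀₂ = planePoint-HD3 X c m o₀ o₂ λ ()

  centre-isCentre : ∀ X c → IsCentre φ (fan (class X) c) (centre X c)
  centre-isCentre X c =
    P o₀ o₀ , P o₀ o₁ , P o₀ o₂ , P o₁ o₀ , P o₁ o₁ , P o₁ o₂ , P o₂ o₀ , P o₂ o₁ , P o₂ o₂ ,
    planePoint-troika X c o₀ , planePoint-troika X c o₁ , planePoint-troika X c o₂ ,
    λ v → mk⇔
      (λ on → let m , n , v≡ = planePoint-complete (class X) c v on
              in pick₃ (λ m → v ≡ P m o₀ ⊎ v ≡ P m o₁ ⊎ v ≡ P m o₂) m
                   (pick₃ (λ n → v ≡ P m n) n v≡))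
      (λ listed → let m , inLine = unpick₃ (λ m → v ≡ P m o₀ ⊎ v ≡ P m o₁ ⊎ v ≡ P m o₂) listed
                      n , v≡ = unpick₃ (λ n → v ≡ P m n) inLine
                  in subst (λ v → fan (class X) c v ≡ true) (sym v≡)
                       (planePoint-fan (class X) c m n))
    where P = planePoint (class X) c

  centre-isCF : ∀ X m → IsCF φ (fan (class X) m) (centre X m)
  centre-isCF X m = centre-isCentre X m ,
    -- A competing centre `c` is the sum of its first troika, which lies in the fan.
    λ { c (x , y , z , _ , _ , _ , _ , _ , _ , (_ , _ , _ , xy , yz , xz , sum) , _ , _ , fan⇔) →
        trans (sym sum) (fan-troika-sum X m x y z (λ v v∈ → from (fan⇔ v) (inj₁ v∈)) xy yz xz) }

  triplet-line : ∀ X → LineIs (triplet (class X)) (PV X)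
  triplet-line X =
    centre X o₀ , centre X o₁ , centre X o₂ ,
    centre-isCF X o₀ , centre-isCF X o₁ , centre-isCF X o₂ ,
    λ v → mk⇔
      (λ v≡ → let m , v≡m = unpick₃ (λ m → v ≡ centre X m) v≡
              in subst (PV X) (sym v≡m) (place∈PV X (e X (π X m)) (e-NZ X (π X m))))
      (λ v∈ → let nz , v≡ = PV⇒place X v v∈
                  -- The three levels realise all three nonzero `X`-components, so each point of the
                  -- line is a centre.
                  m , π≡ = π-surjective X (log X (comp X v))
              in pick₃ (λ m → v ≡ centre X m) m
                   (trans v≡ (cong (place X)
                     (trans (sym (e-log X (comp X v) nz)) (cong (e X) (sym π≡))))))

-- The four triplets and their lines

theorem11 : (φ : Tensor3 → V8) → IsLinIso φ → (∀ v → InS φ v → Ω₄ v) →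
    Σ[ Ta ∈ Triplet φ ] Σ[ Tb ∈ Triplet φ ] Σ[ Tc ∈ Triplet φ ] Σ[ Td ∈ Triplet φ ]
    ((∀ T → SameTriplet T Ta ⊎ SameTriplet T Tb ⊎ SameTriplet T Tc ⊎ SameTriplet T Td) ×
    ¬ SameTriplet Ta Tb × ¬ SameTriplet Ta Tc × ¬ SameTriplet Ta Td ×
    ¬ SameTriplet Tb Tc × ¬ SameTriplet Tb Td × ¬ SameTriplet Tc Td ×
    LineIs Ta PVa × LineIs Tb PVb × LineIs Tc PVc × LineIs Td PVd)
theorem11 φ iso S⊆Ω₄ =
  T a , T b , T c , T d , complete ,
  triplet-distinct a b (λ ()) , triplet-distinct a c (λ ()) , triplet-distinct a d (λ ()) ,
  triplet-distinct b c (λ ()) , triplet-distinct b d (λ ()) , triplet-distinct c d (λ ()) ,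
  triplet-line a , triplet-line b , triplet-line c , triplet-line d
  where
  open Segre φ iso S⊆Ω₄
  a b c d : Fin 4
  a = f0
  b = fs f0
  c = fs (fs f0)
  d = fs (fs (fs f0))
  T : Fin 4 → Triplet φ
  T X = triplet (class X)
  select : ∀ U X → SameTriplet U (T X) →
           SameTriplet U (T a) ⊎ SameTriplet U (T b) ⊎ SameTriplet U (T c) ⊎ SameTriplet U (T d)
  select U f0 same = inj₁ same
  select U (fs f0) same = inj₂ (inj₁ same)
  select U (fs (fs f0)) same = inj₂ (inj₂ (inj₁ same))
  select U (fs (fs (fs f0))) same = inj₂ (inj₂ (inj₂ same))
  complete : ∀ U →
    SameTriplet U (T a) ⊎ SameTriplet U (T b) ⊎ SameTriplet U (T c) ⊎ SameTriplet U (T d)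
  complete U =
    let κ , same = triplet-complete U
        -- The four components realise all four sign classes, so the class of `U` belongs to one of
        -- them.
        X , class≡κ = class-surjective κ
    in select U X (subst (λ κ → SameTriplet U (triplet κ)) (sym class≡κ) same)
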